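{- Let $\alpha,\beta$ be positive real numbers with $\alpha\beta=\pi^2$ and let $k,N$ be positive integers. Then $$ \begin{aligned} \beta^{k(N+1)-1}\sum_{n=1}^{\infty}\frac{(-1)^{n-1}F_\alpha(n,1;k)}{n^{2k(N+1)-1}} &=(-1)^N\alpha^{k(N+1)-1}\sum_{n=1}^{\infty}\frac{(-1)^{n-1}F_\beta(n,1;k)}{n^{2k(N+1)-1}}\\ &\quad+\sum_{p=0}^{N+1}(-1)^{p+1}\zeta_E(2kp,1)\,\zeta_E(2k(N-p+1),1)\,\alpha^{kp-1}\beta^{k(N+1-p)-1}. \end{aligned} $$
   Context: The alternating Hurwitz zeta function is $\zeta_E(z,x)=\sum_{n=0}^{\infty}\frac{(-1)^n}{(n+x)^z}$ for $\operatorname{Re}(z)>0$, continued analytically in $z$ to all of $\mathbb{C}$ (in particular to $z=0$). For $x>0$ and a positive integer $k$, the even-order alternating Hurwitz kernel is $$F(x,a;k)=\frac{1}{2\pi i}\int_{(c)}\frac{\zeta_E(1-s,a)}{2k\cos\left(\frac{\pi(s+k-1)}{2k}\right)}x^{ -s}\,ds=-\frac{1}{2\pi x}+\frac{x^{2k-1}}{\pi}\sum_{n=0}^{\infty}\frac{(-1)^n}{(n+a)^{2k}+x^{2k}},$$ where $(c)$ is the vertical line $\operatorname{Re}(s)=c$ with $1<c<2$. For $\alpha>0$, $F_\alpha(x,a;k)=F\!\left(\frac{\alpha x}{\pi},a;k\right)$, and similarly $F_\beta$. -}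

module Defs where

open import Level using (Level; _⊔_) renaming (suc to lsuc)
open import Algebra.Bundles using (CommutativeRing)
open import Algebra.Apartness.Bundles using (HeytingField)
open import Data.Fin.Base using (toℕ)
open import Data.Integer.Base using (ℤ; +_; -[1+_]; _⊖_)
open import Data.Nat.Base as ℕ using (ℕ; zero; suc; NonZero; _!)
import Data.Nat.Properties as ℕₚ
open import Data.Product.Base as Prod using (∃-syntax; Σ-syntax; _,_; proj₁; proj₂)
open import Data.Sum.Base using (_⊎_; inj₁; inj₂)
open import Data.Empty using (⊥-elim)
open import Relation.Nullary.Negation using (¬_)
open import Relation.Binary.Core using (Rel)
open import Relation.Binary.Structures using (IsStrictPartialOrder)
import Relation.Binary.PropositionalEquality as ≡
import Relation.Binary.Reasoning.Setoid as SetoidReasoning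
import Algebra.Properties.Ring as RingProperties
import Algebra.Properties.Semiring.Exp as Exp
import Algebra.Properties.Semiring.Mult as Mult
import Algebra.Properties.Semiring.Sum as Sum
import Algebra.Solver.Ring.NaturalCoefficients.Default as NaturalSolver

-- The library has no type of real numbers, so ℝ is specified as a
-- Cauchy-complete Archimedean ordered field.  Classically this determines
-- ℝ up to a unique isomorphism.  The order axioms are the constructive ones:
-- weak linearity of _<_ comes from cotransitivity of the apartness _#_, and
-- trichotomy is not assumed.

record RealField (c ℓ₁ ℓ₂ ℓ₃ : Level) : Set (lsuc (c ⊔ ℓ₁ ⊔ ℓ₂ ⊔ ℓ₃)) where
  infix 4 _<_
  field
    heytingField : HeytingField c ℓ₁ ℓ₂

  open HeytingField heytingField public

  commutativeRing : CommutativeRing c ℓ₁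
  commutativeRing = record { isCommutativeRing = isCommutativeRing }

  open CommutativeRing commutativeRing using (semiring)
  open Mult semiring using () renaming (_×_ to _ℕ×_)

  field
    _<_                  : Rel Carrier ℓ₃
    isStrictPartialOrder : IsStrictPartialOrder _≈_ _<_
    #⇒<⊎>                : ∀ {x y} → x # y → x < y ⊎ y < x
    <⇒#                  : ∀ {x y} → x < y → x # y
    +-monoʳ-<            : ∀ x {y z} → y < z → x + y < x + z
    *-pos                : ∀ {x y} → 0# < x → 0# < y → 0# < x * y
    archimedean          : ∀ x → ∃[ n ] x < n ℕ× 1#

  Near : Carrier → Carrier → Carrier → Set ℓ₃
  Near ε x y = (x - y < ε) Prod.× (y - x < ε)

  IsCauchy : (ℕ → Carrier) → Set (c ⊔ ℓ₃)
  IsCauchy u = ∀ ε → 0# < ε → ∃[ M ] (∀ m n → M ℕ.≤ m → M ℕ.≤ n → Near ε (u m) (u n))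

  _⟶_ : (ℕ → Carrier) → Carrier → Set (c ⊔ ℓ₃)
  u ⟶ l = ∀ ε → 0# < ε → ∃[ M ] (∀ n → M ℕ.≤ n → Near ε (u n) l)

  field
    complete : ∀ u → IsCauchy u → ∃[ l ] u ⟶ l

module Analysis {c ℓ₁ ℓ₂ ℓ₃ : Level} (R : RealField c ℓ₁ ℓ₂ ℓ₃) where

  open RealField R public hiding (zero) renaming (Carrier to ℝ)
  open CommutativeRing commutativeRing public
    using (semiring; ring)
  open Exp semiring public using (_^_)
  open Mult semiring public using () renaming (_×_ to _ℕ×_)
  open Sum semiring public using (sum)

  -- The sum of f 0, …, f (n - 1).
  partialSum : (ℕ → ℝ) → ℕ → ℝ
  partialSum f n = sum {n} (λ i → f (toℕ i))

  HasSum : (ℕ → ℝ) → ℝ → Set (c ⊔ ℓ₃)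
  HasSum f s = partialSum f ⟶ s

  sign : ℕ → ℝ
  sign n = (- 1#) ^ n

  module SPO = IsStrictPartialOrder isStrictPartialOrder
  open RingProperties ring
  open SetoidReasoning setoid

  <-trans : ∀ {x y z} → x < y → y < z → x < z
  <-trans = SPO.trans

  <-irrefl : ∀ {x} → ¬ x < x
  <-irrefl = SPO.irrefl refl

  <-resp : ∀ {x x′ y y′} → x ≈ x′ → y ≈ y′ → x < y → x′ < y′
  <-resp p q x<y = proj₂ SPO.<-resp-≈ p (proj₁ SPO.<-resp-≈ q x<y)

  +-monoˡ-< : ∀ z {x y} → x < y → x + z < y + z
  +-monoˡ-< z p = <-resp (+-comm _ _) (+-comm _ _) (+-monoʳ-< z p)

  +-mono-< : ∀ {x y u v} → x < y → u < v → x + u < y + v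
  +-mono-< p q = <-trans (+-monoˡ-< _ p) (+-monoʳ-< _ q)

  +-pos : ∀ {x y} → 0# < x → 0# < y → 0# < x + y
  +-pos p q = <-resp (+-identityˡ 0#) refl (+-mono-< p q)

  x<x+p : ∀ {x p} → 0# < p → x < x + p
  x<x+p p = <-resp (+-identityʳ _) refl (+-monoʳ-< _ p)

  x<p+x : ∀ {x p} → 0# < p → x < p + x
  x<p+x p = <-resp (+-identityˡ _) refl (+-monoˡ-< _ p)

  x-y+y : ∀ x y → x - y + y ≈ x
  x-y+y x y = trans (+-assoc _ _ _) (trans (+-congˡ (-‿inverseˡ y)) (+-identityʳ x))

  x+y-y : ∀ x y → x + y - y ≈ x
  x+y-y x y = trans (+-assoc _ _ _) (trans (+-congˡ (-‿inverseʳ y)) (+-identityʳ x))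

  <⇒0<- : ∀ {x y} → x < y → 0# < y - x
  <⇒0<- p = <-resp (-‿inverseʳ _) refl (+-monoˡ-< _ p)

  0<-⇒< : ∀ {x y} → 0# < y - x → x < y
  0<-⇒< p = <-resp (+-identityˡ _) (x-y+y _ _) (+-monoˡ-< _ p)

  -<⇒<+ : ∀ {x y z} → x - y < z → x < z + y
  -<⇒<+ p = <-resp (x-y+y _ _) refl (+-monoˡ-< _ p)

  <+⇒-< : ∀ {x y z} → x < z + y → x - y < z
  <+⇒-< p = <-resp refl (x+y-y _ _) (+-monoˡ-< _ p)

  neg<0 : ∀ {x} → x < 0# → 0# < - x
  neg<0 p = <-resp refl (+-identityˡ _) (<⇒0<- p)

  x+t<x⇒t<0 : ∀ {x t} → x + t < x → t < 0#
  x+t<x⇒t<0 p =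
    <-resp (trans (sym (+-assoc _ _ _)) (trans (+-congʳ (-‿inverseˡ _)) (+-identityˡ _)))
           (-‿inverseˡ _) (+-monoʳ-< _ p)

  x<x-t⇒t<0 : ∀ {x t} → x < x - t → t < 0#
  x<x-t⇒t<0 p = x+t<x⇒t<0 (<-resp refl (x-y+y _ _) (+-monoˡ-< _ p))

  <-cotrans : ∀ {x y} → x < y → ∀ z → x < z ⊎ z < y
  <-cotrans p z with #-cotrans (<⇒# p) z
  ... | inj₁ x#z with #⇒<⊎> x#z
  ...   | inj₁ x<z = inj₁ x<z
  ...   | inj₂ z<x = inj₂ (<-trans z<x p)
  <-cotrans p z | inj₂ z#y with #⇒<⊎> z#y
  ...   | inj₁ z<y = inj₂ z<y
  ...   | inj₂ y<z = inj₁ (<-trans p y<z)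

  0<1 : 0# < 1#
  0<1 with #⇒<⊎> (invertible⇒# {1#} {0#} (1# , trans (*-identityˡ _) 1-0 , trans (*-identityʳ _) 1-0))
    where
    1-0 : 1# - 0# ≈ 1#
    1-0 = trans (+-congˡ -0#≈0#) (+-identityʳ 1#)
  ... | inj₂ 0<1# = 0<1#
  ... | inj₁ 1<0  = ⊥-elim (<-irrefl (<-trans 1<0 (<-resp refl eq (*-pos 0<-1 0<-1))))
    where
    0<-1 : 0# < - 1#
    0<-1 = neg<0 1<0
    eq : - 1# * - 1# ≈ 1#
    eq = trans (-1*x≈-x (- 1#)) (-‿involutive 1#)

  *-monoʳ-< : ∀ {z x y} → 0# < z → x < y → z * x < z * y
  *-monoʳ-< 0<z p = 0<-⇒< (<-resp refl (x[y-z]≈xy-xz _ _ _) (*-pos 0<z (<⇒0<- p)))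

  *-monoˡ-< : ∀ {z x y} → 0# < z → x < y → x * z < y * z
  *-monoˡ-< 0<z p = <-resp (*-comm _ _) (*-comm _ _) (*-monoʳ-< 0<z p)

  ^-pos : ∀ {x} → 0# < x → ∀ n → 0# < x ^ n
  ^-pos p zero    = 0<1
  ^-pos p (suc n) = *-pos p (^-pos p n)

  ^-mono-< : ∀ {x y} → 0# < x → x < y → ∀ n → x ^ suc n < y ^ suc n
  ^-mono-< 0<x p zero    = *-monoˡ-< 0<1 p
  ^-mono-< 0<x p (suc n) =
    <-trans (*-monoˡ-< (^-pos 0<x (suc n)) p)
            (*-monoʳ-< (<-trans 0<x p) (^-mono-< 0<x p n))

  <⇒<^ : ∀ {b x} → 1# < x → b < x → ∀ n → b < x ^ suc n
  <⇒<^ 1<x b<x zero    = <-resp refl (sym (*-identityʳ _)) b<x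
  <⇒<^ 1<x b<x (suc n) =
    <-trans (<⇒<^ 1<x b<x n)
            (<-resp (*-identityˡ _) refl (*-monoˡ-< (^-pos (<-trans 0<1 1<x) (suc n)) 1<x))

  recip : ∀ {x} → 0# < x → ∃[ y ] x * y ≈ 1# Prod.× 0# < y
  recip {x} 0<x with #⇒invertible (#-sym (<⇒# 0<x))
  ... | y , yx , xy = y , x*y , 0<y
    where
    z-0 : ∀ z → z - 0# ≈ z
    z-0 z = trans (+-congˡ -0#≈0#) (+-identityʳ z)
    x*y : x * y ≈ 1#
    x*y = trans (*-congʳ (sym (z-0 x))) xy
    0<y : 0# < y
    0<y with #⇒<⊎> (invertible⇒# {y} {0#}
               (x , trans (*-congˡ (z-0 y)) x*y
                  , trans (*-congʳ (z-0 y)) (trans (*-comm y x) x*y)))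
    ... | inj₂ p = p
    ... | inj₁ p = ⊥-elim (<-irrefl (<-trans 0<1 (<-resp x*y (zeroʳ x) (*-monoʳ-< 0<x p))))

  record ℝ⁺ : Set (c ⊔ ℓ₃) where
    constructor _,⁺_
    field
      val : ℝ
      pos : 0# < val

  open ℝ⁺ public

  infix  9 _⁻¹
  infixl 7 _*⁺_
  infixl 6 _+⁺_
  infixr 8 _^⁺_ _^ℤ_

  1⁺ : ℝ⁺
  1⁺ = 1# ,⁺ 0<1

  _+⁺_ _*⁺_ : ℝ⁺ → ℝ⁺ → ℝ⁺
  (x ,⁺ p) +⁺ (y ,⁺ q) = (x + y) ,⁺ +-pos p q
  (x ,⁺ p) *⁺ (y ,⁺ q) = (x * y) ,⁺ *-pos p q

  _⁻¹ : ℝ⁺ → ℝ⁺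
  (x ,⁺ p) ⁻¹ = proj₁ (recip p) ,⁺ proj₂ (proj₂ (recip p))

  *-inverseʳ : ∀ x → val x * val (x ⁻¹) ≈ 1#
  *-inverseʳ (x ,⁺ p) = proj₁ (proj₂ (recip p))

  _^⁺_ : ℝ⁺ → ℕ → ℝ⁺
  (x ,⁺ p) ^⁺ n = (x ^ n) ,⁺ ^-pos p n

  _^ℤ_ : ℝ⁺ → ℤ → ℝ⁺
  x ^ℤ (+ n)    = x ^⁺ n
  x ^ℤ -[1+ n ] = (x ⁻¹) ^⁺ suc n

  -- shift n x is n + x.
  shift : ℕ → ℝ⁺ → ℝ⁺
  shift n x = (n ℕ× 1# + val x) ,⁺ positive n
    where
    positive : ∀ n → 0# < n ℕ× 1# + val x
    positive zero    = <-resp refl (sym (+-identityˡ _)) (pos x)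
    positive (suc n) = <-resp refl (sym (+-assoc _ _ _)) (+-pos 0<1 (positive n))

  fromℕ⁺ : (n : ℕ) .{{_ : NonZero n}} → ℝ⁺
  fromℕ⁺ (suc n) = shift n 1⁺

  ⁻¹-anti : ∀ x y → val x < val y → val (y ⁻¹) < val (x ⁻¹)
  ⁻¹-anti x y p = <-resp eq₁ eq₂ (*-monoˡ-< (*-pos (pos (x ⁻¹)) (pos (y ⁻¹))) p)
    where
    eq₁ : val x * (val (x ⁻¹) * val (y ⁻¹)) ≈ val (y ⁻¹)
    eq₁ = trans (sym (*-assoc _ _ _)) (trans (*-congʳ (*-inverseʳ x)) (*-identityˡ _))
    eq₂ : val y * (val (x ⁻¹) * val (y ⁻¹)) ≈ val (x ⁻¹)
    eq₂ = trans (*-congˡ (*-comm _ _)) (trans (sym (*-assoc _ _ _))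
            (trans (*-congʳ (*-inverseʳ y)) (*-identityˡ _)))

  ⁻¹-flip : ∀ x y → val (x ⁻¹) < val y → val (y ⁻¹) < val x
  ⁻¹-flip x y p = <-resp refl x⁻¹⁻¹ (⁻¹-anti (x ⁻¹) y p)
    where
    x⁻¹⁻¹ : val ((x ⁻¹) ⁻¹) ≈ val x
    x⁻¹⁻¹ = begin
      val ((x ⁻¹) ⁻¹)                            ≈⟨ *-identityˡ _ ⟨
      1# * val ((x ⁻¹) ⁻¹)                       ≈⟨ *-congʳ (*-inverseʳ x) ⟨
      val x * val (x ⁻¹) * val ((x ⁻¹) ⁻¹)       ≈⟨ *-assoc _ _ _ ⟩
      val x * (val (x ⁻¹) * val ((x ⁻¹) ⁻¹))     ≈⟨ *-congˡ (*-inverseʳ (x ⁻¹)) ⟩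
      val x * 1#                                 ≈⟨ *-identityʳ _ ⟩
      val x                                      ∎

  shift-< : ∀ n x → val (shift n x) < val (shift (suc n) x)
  shift-< n x = <-resp refl (sym (+-assoc _ _ _)) (x<p+x 0<1)

  shift-unbounded : ∀ b → 0# < b → ∀ x →
    ∃[ n ] 1# < val (shift n x) Prod.× b < val (shift n x)
  shift-unbounded b 0<b x with archimedean b
  ... | n , b<n = suc n , <-trans (x<x+p (<-trans 0<b b<n)) (x<x+p (pos x))
                        , <-trans b<n (<-trans (x<p+x 0<1) (x<x+p (pos x)))

  alternating : (ℕ → ℝ) → ℕ → ℝ
  alternating a n = sign n * a n

  record IsLeibniz (a : ℕ → ℝ) : Set (c ⊔ ℓ₃) where
    field
      positive   : ∀ n → 0# < a n
      decreasing : ∀ n → a (suc n) < a n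
      null       : ∀ ε → 0# < ε → ∃[ n ] a n < ε

  sum-neg : ∀ (f g : ℕ → ℝ) → (∀ n → f n ≈ - g n) → ∀ n → partialSum f n ≈ - partialSum g n
  sum-neg f g eq zero    = sym -0#≈0#
  sum-neg f g eq (suc n) =
    trans (+-cong (eq 0) (sum-neg (λ i → f (suc i)) (λ i → g (suc i)) (λ i → eq (suc i)) n))
          (-‿+-comm (g 0) (partialSum (λ i → g (suc i)) n))

  unfold : ∀ a n → partialSum (alternating a) (suc n)
                 ≈ a 0 - partialSum (alternating (λ i → a (suc i))) n
  unfold a n = +-cong (*-identityˡ (a 0)) (sum-neg _ _ step n)
    where
    step : ∀ i → alternating a (suc i) ≈ - alternating (λ i → a (suc i)) i
    step i = trans (*-assoc _ _ _) (-1*x≈-x _)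

  tail : ∀ {a} → IsLeibniz a → IsLeibniz (λ i → a (suc i))
  tail {a} L = record
    { positive   = λ n → positive (suc n)
    ; decreasing = λ n → decreasing (suc n)
    ; null       = λ ε p → let n , q = null ε p in n , <-trans (decreasing n) q
    } where open IsLeibniz L

  lower : ∀ {a} → IsLeibniz a → ∀ n → ¬ partialSum (alternating a) n < 0#
  upper : ∀ {a} → IsLeibniz a → ∀ n → ¬ a 0 < partialSum (alternating a) n

  lower L zero    p = <-irrefl p
  lower {a} L (suc n) p = upper (tail L) n (<-trans (IsLeibniz.decreasing L 0)
    (<-resp refl (+-identityˡ _) (-<⇒<+ (<-resp (unfold a n) refl p))))

  upper L zero    p = <-irrefl (<-trans (IsLeibniz.positive L 0) p)
  upper {a} L (suc n) p = lower (tail L) n (x<x-t⇒t<0 (<-resp refl (unfold a n) p))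

  near : ∀ {ε x y b} → b < ε → ¬ b < x → ¬ y < 0# → x - y < ε
  near b<ε x≤b 0≤y with <-cotrans b<ε _
  ... | inj₁ b<x = ⊥-elim (x≤b b<x)
  ... | inj₂ x<ε with <-cotrans x<ε _
  ... | inj₁ x<ε+y = <+⇒-< x<ε+y
  ... | inj₂ ε+y<ε = ⊥-elim (0≤y (x+t<x⇒t<0 ε+y<ε))

  reflect : ∀ b x y → (b - x) - (b - y) ≈ y - x
  reflect b x y = begin
    (b - x) - (b - y)      ≈⟨ +-congˡ (-‿+-comm b (- y)) ⟨
    (b - x) + (- b - - y)  ≈⟨ +-congˡ (+-congˡ (-‿involutive y)) ⟩
    (b - x) + (- b + y)    ≈⟨ +-congʳ (+-comm b (- x)) ⟩
    (- x + b) + (- b + y)  ≈⟨ +-assoc _ _ _ ⟩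
    - x + (b + (- b + y))  ≈⟨ +-congˡ (+-assoc _ _ _) ⟨
    - x + (b - b + y)      ≈⟨ +-congˡ (+-congʳ (-‿inverseʳ b)) ⟩
    - x + (0# + y)         ≈⟨ +-congˡ (+-identityˡ y) ⟩
    - x + y                ≈⟨ +-comm _ _ ⟩
    y - x                  ∎

  tails-near : ∀ {a} → IsLeibniz a → ∀ {ε} M → a M < ε → ∀ i j →
    Near ε (partialSum (alternating a) (M ℕ.+ i)) (partialSum (alternating a) (M ℕ.+ j))
  tails-near L zero    p i j = near p (upper L i) (lower L j) , near p (upper L j) (lower L i)
  tails-near {a} L (suc M) p i j =
    <-resp (sym (trans (-‿cong₂ i j) (reflect _ _ _))) refl (proj₂ ih) ,
    <-resp (sym (trans (-‿cong₂ j i) (reflect _ _ _))) refl (proj₁ ih)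
    where
    ih = tails-near (tail L) M p i j
    -‿cong₂ : ∀ i j → _
    -‿cong₂ i j = +-cong (unfold a (M ℕ.+ i)) (-‿cong (unfold a (M ℕ.+ j)))

  leibniz-cauchy : ∀ {a} → IsLeibniz a → IsCauchy (partialSum (alternating a))
  leibniz-cauchy {a} L ε 0<ε = M , λ m n M≤m M≤n →
    ≡.subst₂ (λ m n → Near ε (S m) (S n)) (ℕₚ.m+[n∸m]≡n M≤m) (ℕₚ.m+[n∸m]≡n M≤n)
      (tails-near L M (proj₂ (IsLeibniz.null L ε 0<ε)) (m ℕ.∸ M) (n ℕ.∸ M))
    where
    M = proj₁ (IsLeibniz.null L ε 0<ε)
    S = partialSum (alternating a)

  leibniz : ∀ {a} → IsLeibniz a → ∃[ s ] HasSum (alternating a) s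
  leibniz L = complete _ (leibniz-cauchy L)

  alternatingSum : ∀ {a} → IsLeibniz a → ℝ
  alternatingSum L = proj₁ (leibniz L)

  alternatingSum-pos : ∀ {a} (L : IsLeibniz a) → 0# < alternatingSum L
  alternatingSum-pos {a} L with <-cotrans 0<ε (alternatingSum L)
    where
    half = recip (+-pos 0<1 0<1)
    ε = (a 0 - a 1) * proj₁ half
    0<ε : 0# < ε
    0<ε = *-pos (<⇒0<- (IsLeibniz.decreasing L 0)) (proj₂ (proj₂ half))
  ... | inj₁ p = p
  ... | inj₂ p = ⊥-elim (upper (tail L) (suc M) (a₁<t p))
    where
    half = recip (+-pos 0<1 0<1)
    ε = (a 0 - a 1) * proj₁ half
    0<ε : 0# < ε
    0<ε = *-pos (<⇒0<- (IsLeibniz.decreasing L 0)) (proj₂ (proj₂ half))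
    ε+ε : ε + ε ≈ a 0 - a 1
    ε+ε = begin
      ε + ε                                      ≈⟨ distribˡ _ _ _ ⟨
      (a 0 - a 1) * (proj₁ half + proj₁ half)    ≈⟨ *-congˡ (+-cong (*-identityˡ _) (*-identityˡ _)) ⟨
      (a 0 - a 1) * (1# * proj₁ half + 1# * proj₁ half) ≈⟨ *-congˡ (distribʳ _ _ _) ⟨
      (a 0 - a 1) * ((1# + 1#) * proj₁ half)     ≈⟨ *-congˡ (proj₁ (proj₂ half)) ⟩
      (a 0 - a 1) * 1#                           ≈⟨ *-identityʳ _ ⟩
      a 0 - a 1                                  ∎
    s = alternatingSum L
    lim = proj₂ (leibniz L) ε 0<ε
    M = proj₁ lim
    t : ℝ
    t = partialSum (alternating (λ i → a (suc i))) (suc M)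
    a₁<t : s < ε → a 1 < t
    a₁<t s<ε = 0<-⇒< (<-resp refl (reflect (a 0) (a 1) t) (<⇒0<- a₀-t<))
      where
      n≥M : M ℕ.≤ suc (suc M)
      n≥M = ℕₚ.≤-trans (ℕₚ.n≤1+n M) (ℕₚ.n≤1+n (suc M))
      a₀-t< : a 0 - t < a 0 - a 1
      a₀-t< = <-resp (unfold a (suc M)) ε+ε
        (<-trans (-<⇒<+ (proj₁ (proj₂ lim (suc (suc M)) n≥M))) (+-monoʳ-< ε s<ε))

  odd : ℕ → ℝ⁺
  odd n = fromℕ⁺ (suc (2 ℕ.* n))

  recipOdd : ℕ → ℝ
  recipOdd n = val (odd n ⁻¹)

  shift-mono : ∀ x {m n} → m ℕ.<′ n → val (shift m x) < val (shift n x)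
  shift-mono x {m} ℕ.≤′-refl     = shift-< m x
  shift-mono x {m} (ℕ.≤′-step {n} p) = <-trans (shift-mono x {m} {n} p) (shift-< n x)

  odd-< : ∀ n → val (odd n) < val (odd (suc n))
  odd-< n = shift-mono 1⁺ (ℕₚ.≤⇒≤′ (ℕₚ.*-monoʳ-< 2 (ℕₚ.n<1+n n)))

  recipOdd-leibniz : IsLeibniz recipOdd
  recipOdd-leibniz = record
    { positive   = λ n → pos (odd n ⁻¹)
    ; decreasing = λ n → ⁻¹-anti (odd n) (odd (suc n)) (odd-< n)
    ; null       = null
    }
    where
    null : ∀ ε → 0# < ε → ∃[ n ] recipOdd n < ε
    null ε 0<ε with shift-unbounded (val ((ε ,⁺ 0<ε) ⁻¹)) (pos ((ε ,⁺ 0<ε) ⁻¹)) 1⁺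
    ... | zero  , _ , b = zero , ⁻¹-flip (ε ,⁺ 0<ε) (odd zero) b
    ... | suc n , _ , b = suc n , ⁻¹-flip (ε ,⁺ 0<ε) (odd (suc n))
            (<-trans b (shift-mono 1⁺ (ℕₚ.≤⇒≤′ (ℕₚ.m<m+n (suc n) ℕ.z<s))))

  -- Four times the sum of (-1)ⁿ / (2n + 1).
  π : ℝ⁺
  π = fromℕ⁺ 4 *⁺ (alternatingSum recipOdd-leibniz ,⁺ alternatingSum-pos recipOdd-leibniz)

  kernelTerm : (x a : ℝ⁺) (k : ℕ) → ℕ → ℝ
  kernelTerm x a k n = val ((shift n a ^⁺ (2 ℕ.* k) +⁺ x ^⁺ (2 ℕ.* k)) ⁻¹)

  kernelTerm-leibniz : ∀ x a k .{{_ : NonZero k}} → IsLeibniz (kernelTerm x a k)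
  kernelTerm-leibniz x a k@(suc k-1) = record
    { positive   = λ n → pos (D n ⁻¹)
    ; decreasing = λ n → ⁻¹-anti (D n) (D (suc n))
        (+-monoˡ-< _ (^-mono-< (pos (shift n a)) (shift-< n a) (k-1 ℕ.+ 1 ℕ.* k)))
    ; null       = null
    }
    where
    D : ℕ → ℝ⁺
    D n = shift n a ^⁺ (2 ℕ.* k) +⁺ x ^⁺ (2 ℕ.* k)
    null : ∀ ε → 0# < ε → ∃[ n ] kernelTerm x a k n < ε
    null ε 0<ε with shift-unbounded (val ((ε ,⁺ 0<ε) ⁻¹)) (pos ((ε ,⁺ 0<ε) ⁻¹)) a
    ... | n , 1<n+a , b<n+a = n , ⁻¹-flip (ε ,⁺ 0<ε) (D n)
            (<-trans (<⇒<^ 1<n+a b<n+a (k-1 ℕ.+ 1 ℕ.* k)) (x<x+p (pos (x ^⁺ (2 ℕ.* k)))))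

  -- F is defined by its series; the Mellin-Barnes integral of
  -- ζ_E(1-s, a) / (2k cos (π(s+k-1) / (2k))) over a line 1 < Re s < 2
  -- evaluates to it, -1 / (2πx) being the residue at s = 1.
  F : (x a : ℝ⁺) (k : ℕ) .{{_ : NonZero k}} → ℝ
  F x a k = - val ((fromℕ⁺ 2 *⁺ π *⁺ x) ⁻¹)
          + val (x ^ℤ (2 ℕ.* k ⊖ 1) *⁺ π ⁻¹) * alternatingSum (kernelTerm-leibniz x a k)

  -- F[ α ] x is F (αx / π).
  F[_] : (α x a : ℝ⁺) (k : ℕ) .{{_ : NonZero k}} → ℝ
  F[ α ] x a k = F (α *⁺ x *⁺ π ⁻¹) a k

  record ℂ : Set c where
    constructor _+i_
    field
      re im : ℝ

  open ℂ public

  ι : ℝ → ℂ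
  ι x = x +i 0#

  fromℕ : ℕ → ℂ
  fromℕ n = ι (n ℕ× 1#)

  ∣_∣² : ℂ → ℝ
  ∣ x +i y ∣² = x * x + y * y

  open NaturalSolver (CommutativeRing.commutativeSemiring commutativeRing)
    using (solve; _:=_; _:+_; _:*_)

  re-assoc : ∀ a b c d e f →
    (a * c - b * d) * e - (a * d + b * c) * f ≈ a * (c * e - d * f) - b * (c * f + d * e)
  re-assoc a b c d e f = begin
    (a * c - b * d) * e - (a * d + b * c) * f
      ≈⟨ +-cong (*-congʳ (+-congˡ (-‿distribʳ-* b d))) (-‿distribʳ-* _ f) ⟩
    (a * c + b * - d) * e + (a * d + b * c) * - f
      ≈⟨ solve 8 (λ a b c d e f d′ f′ →
           ((a :* c :+ b :* d′) :* e :+ (a :* d :+ b :* c) :* f′)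
           := (a :* (c :* e :+ d :* f′) :+ b :* (c :* f′ :+ d′ :* e)))
           refl a b c d e f (- d) (- f) ⟩
    a * (c * e + d * - f) + b * (c * - f + - d * e)
      ≈⟨ +-cong (*-congˡ (+-congˡ (-‿distribʳ-* d f)))
           (*-congˡ (+-cong (-‿distribʳ-* c f) (-‿distribˡ-* d e))) ⟨
    a * (c * e - d * f) + b * (- (c * f) + - (d * e))
      ≈⟨ +-congˡ (trans (sym (*-congˡ (sym (-‿+-comm _ _)))) (sym (-‿distribʳ-* b _))) ⟩
    a * (c * e - d * f) - b * (c * f + d * e) ∎

  im-assoc : ∀ a b c d e f →
    (a * c - b * d) * f + (a * d + b * c) * e ≈ a * (c * f + d * e) + b * (c * e - d * f)
  im-assoc a b c d e f = begin
    (a * c - b * d) * f + (a * d + b * c) * e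
      ≈⟨ +-congʳ (*-congʳ (+-congˡ (-‿distribʳ-* b d))) ⟩
    (a * c + b * - d) * f + (a * d + b * c) * e
      ≈⟨ solve 7 (λ a b c d e f d′ →
           ((a :* c :+ b :* d′) :* f :+ (a :* d :+ b :* c) :* e)
           := (a :* (c :* f :+ d :* e) :+ b :* (c :* e :+ d′ :* f)))
           refl a b c d e f (- d) ⟩
    a * (c * f + d * e) + b * (c * e + - d * f)
      ≈⟨ +-congˡ (*-congˡ (+-congˡ (-‿distribˡ-* d f))) ⟨
    a * (c * f + d * e) + b * (c * e - d * f) ∎

  re-distribˡ : ∀ a b c d e f →
    a * (c + e) - b * (d + f) ≈ (a * c - b * d) + (a * e - b * f)
  re-distribˡ a b c d e f = begin
    a * (c + e) - b * (d + f)
      ≈⟨ +-congˡ (-‿distribˡ-* b _) ⟩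
    a * (c + e) + - b * (d + f)
      ≈⟨ solve 6 (λ a b′ c d e f →
           (a :* (c :+ e) :+ b′ :* (d :+ f))
           := ((a :* c :+ b′ :* d) :+ (a :* e :+ b′ :* f))) refl a (- b) c d e f ⟩
    (a * c + - b * d) + (a * e + - b * f)
      ≈⟨ +-cong (+-congˡ (-‿distribˡ-* b d)) (+-congˡ (-‿distribˡ-* b f)) ⟨
    (a * c - b * d) + (a * e - b * f) ∎

  im-distrib : ∀ a b c d e f →
    a * (d + f) + b * (c + e) ≈ (a * d + b * c) + (a * f + b * e)
  im-distrib a b c d e f =
    solve 6 (λ a b c d e f →
      (a :* (d :+ f) :+ b :* (c :+ e))
      := ((a :* d :+ b :* c) :+ (a :* f :+ b :* e))) refl a b c d e f

  *-idˡ : ∀ z → (1# * re z - 0# * im z ≈ re z) Prod.× (1# * im z + 0# * re z ≈ im z)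
  *-idˡ z = trans (+-cong (*-identityˡ _) (trans (-‿cong (zeroˡ _)) -0#≈0#)) (+-identityʳ _)
          , trans (+-cong (*-identityˡ _) (zeroˡ _)) (+-identityʳ _)

  ℂ-commutativeRing : CommutativeRing c ℓ₁
  ℂ-commutativeRing = record
    { Carrier = ℂ
    ; _≈_ = λ z w → (re z ≈ re w) Prod.× (im z ≈ im w)
    ; _+_ = λ z w → (re z + re w) +i (im z + im w)
    ; _*_ = λ z w → (re z * re w - im z * im w) +i (re z * im w + im z * re w)
    ; -_  = λ z → (- re z) +i (- im z)
    ; 0#  = ι 0#
    ; 1#  = ι 1#
    ; isCommutativeRing = record
      { isRing = record
        { +-isAbelianGroup = record
          { isGroup = record
            { isMonoid = record
              { isSemigroup = record
                { isMagma = record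
                  { isEquivalence = record
                    { refl  = refl , refl
                    ; sym   = λ (p , q) → sym p , sym q
                    ; trans = λ (p , q) (r , s) → trans p r , trans q s
                    }
                  ; ∙-cong = λ (p , q) (r , s) → +-cong p r , +-cong q s
                  }
                ; assoc = λ _ _ _ → +-assoc _ _ _ , +-assoc _ _ _
                }
              ; identity = (λ _ → +-identityˡ _ , +-identityˡ _)
                         , (λ _ → +-identityʳ _ , +-identityʳ _)
              }
            ; inverse = (λ _ → -‿inverseˡ _ , -‿inverseˡ _)
                      , (λ _ → -‿inverseʳ _ , -‿inverseʳ _)
            ; ⁻¹-cong = λ (p , q) → -‿cong p , -‿cong q
            }
          ; comm = λ _ _ → +-comm _ _ , +-comm _ _
          }
        ; *-cong = λ (p , q) (r , s) →
            +-cong (*-cong p r) (-‿cong (*-cong q s)) , +-cong (*-cong p s) (*-cong q r)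
        ; *-assoc = λ (a +i b) (c +i d) (e +i f) →
            re-assoc a b c d e f
          , im-assoc a b c d e f
        ; *-identity = (λ z → *-idˡ z) , (λ z → trans (+-cong (*-comm _ _) (-‿cong (*-comm _ _))) (proj₁ (*-idˡ z))
                                              , trans (+-comm _ _) (trans (+-cong (*-comm _ _) (*-comm _ _)) (proj₂ (*-idˡ z))))
        ; distrib = (λ (a +i b) (c +i d) (e +i f) → re-distribˡ a b c d e f , im-distrib a b c d e f)
                  , (λ (a +i b) (c +i d) (e +i f) →
                       trans (+-cong (*-comm _ _) (-‿cong (*-comm _ _)))
                         (trans (re-distribˡ a b c d e f)
                           (+-cong (+-cong (*-comm _ _) (-‿cong (*-comm _ _)))
                                   (+-cong (*-comm _ _) (-‿cong (*-comm _ _))))) ,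
                       solve 6 (λ a b c d e f →
                         ((c :+ e) :* b :+ (d :+ f) :* a)
                         := ((c :* b :+ d :* a) :+ (e :* b :+ f :* a))) refl a b c d e f)
        }
      ; *-comm = λ _ _ → +-cong (*-comm _ _) (-‿cong (*-comm _ _))
                       , trans (+-comm _ _) (+-cong (*-comm _ _) (*-comm _ _))
      }
    }

  module C where
    open CommutativeRing ℂ-commutativeRing public
    open Exp (CommutativeRing.semiring ℂ-commutativeRing) public using (_^_)
    open Sum (CommutativeRing.semiring ℂ-commutativeRing) public using (sum)

  HasSumℂ : (ℕ → ℂ) → ℂ → Set (c ⊔ ℓ₃)
  HasSumℂ f s = ∀ ε → 0# < ε → ∃[ M ] (∀ n → M ℕ.≤ n →
    ∣ C.sum {n} (λ i → f (toℕ i)) C.- s ∣² < ε * ε)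

  -- Functions of a complex variable that would need a convergence proof to be
  -- total are given by their graphs: IsExp z w says e^z = w, and
  -- IsPower b z w says b^z = w, where b^z = e^(z log b).

  factorial⁺ : ℕ → ℝ⁺
  factorial⁺ n = fromℕ⁺ (n !) {{n ℕₚ.!≢0}}

  IsExp : ℂ → ℂ → Set (c ⊔ ℓ₃)
  IsExp z w = HasSumℂ (λ n → ι (val (factorial⁺ n ⁻¹)) C.* z C.^ n) w

  IsLog : ℝ⁺ → ℝ → Set (c ⊔ ℓ₃)
  IsLog b l = IsExp (ι l) (ι (val b))

  IsPower : ℝ⁺ → ℂ → ℂ → Set (c ⊔ ℓ₃)
  IsPower b z w = ∃[ l ] IsLog b l Prod.× IsExp (z C.* ι l) w

  IsEntire : (ℂ → ℂ) → Set (c ⊔ ℓ₃)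
  IsEntire f = ∀ z → ∃[ d ] (∀ ε → 0# < ε → ∃[ δ ] 0# < δ Prod.× (∀ h → ∣ h ∣² < δ * δ →
    ¬ (ε * ε * ∣ h ∣² < ∣ f (z C.+ h) C.- f z C.- d C.* h ∣²)))

  -- ζ is z ↦ ζ_E(z, a): the entire function which for Re z > 0 is the sum of
  -- (-1)ⁿ (n + a)^(-z).  By the identity theorem there is only one.
  record IsAlternatingHurwitzZeta (a : ℝ⁺) (ζ : ℂ → ℂ) : Set (c ⊔ ℓ₁ ⊔ ℓ₃) where
    field
      cong   : ∀ {z w} → z C.≈ w → ζ z C.≈ ζ w
      entire : IsEntire ζ
      series : ∀ z → 0# < re z → Σ[ t ∈ (ℕ → ℂ) ] (∀ n → IsPower (shift n a) (C.- z) (t n))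
                 Prod.× HasSumℂ (λ n → ι (sign n) C.* t n) (ζ z)

{-# OPTIONS --safe #-}

-- Put A i = (i + 1)^(2k), B i = 1 / A i, ρ = (α / π)^(2k) and
-- κ i m = 1 / (A m + ρ A i).  Up to a constant the series for F_α is the double
-- sum of ± ρ κ i m (B i)ᴺ, and αβ = π² turns the kernel for β into ρ κ m i, so
-- the series for F_β is the same double sum with (B m)ᴺ in place of ρ (B i)ᴺ.
-- Partial fractions write ρ κ i m ((B i)ᴺ - (- ρ B m)ᴺ) as a finite sum of
-- products of powers of B i and B m, which sum to products of zeta values.  The
-- order of summation is only exchanged over squares i, m < M: truncating the
-- inner alternating series there changes the double sum by at most ρ / (M + 1).
--
-- The terms p = 0 and p = N + 1 need ζ_E(0, 1) = 1/2, obtained by continuity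
-- from ζ_E(1/q, 1) with q odd: the sequence (n + 1)^(-1/q) is convex, so twice
-- its alternating sum differs from 1 by at most 1 - 2^(-1/q) ≤ 1/q.
module Submission where

open import Defs
open import Algebra.Bundles using (CommutativeRing)
import Algebra.Properties.CommutativeSemiring.Exp as CommutativeExp
import Algebra.Properties.Ring as RingProperties
import Algebra.Properties.Semiring.Mult as Multiples
import Algebra.Properties.Semiring.Mult.TCOptimised as OptimisedMultiples
import Algebra.Properties.Semiring.Sum as Sums
import Algebra.Solver.Ring
import Algebra.Solver.Ring.AlmostCommutativeRing as ACR
open import Data.Bool.Base using (T)
open import Data.Empty using (⊥-elim)
open import Data.Fin.Base using (toℕ)
open import Data.Integer.Base as ℤ using (ℤ; +_; -[1+_]; _⊖_)
import Data.Integer.Properties as ℤₚ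
open import Data.Maybe.Base as Maybe using (Maybe; just; is-just)
open import Data.Nat.Base as ℕ using (ℕ; zero; suc; NonZero; _!)
import Data.Nat.Properties as ℕₚ
open import Data.Product.Base using (∃-syntax; _×_; _,_; proj₁; proj₂)
open import Data.Sum.Base using (_⊎_; inj₁; inj₂)
open import Data.Vec.Base as Vec using (allFin)
open import Data.Vec.N-ary using (N-ary; _$ⁿ_; curryⁿ; curryⁿ-cong; Eq)
open import Level using (Level; _⊔_)
open import Relation.Binary.PropositionalEquality as ≡ using (_≡_)
import Relation.Binary.Reasoning.Setoid as SetoidReasoning
open import Relation.Nullary.Decidable using (dec⇒maybe)
open import Relation.Nullary.Negation using (¬_)

-- The two end terms of the sum come from the residue: multiplied by γn, the summand -1/(2πx) of F
-- becomes the constant -1/2. It contributes -1/2 times ζ_E(2k(N+1), 1) on the α side and a matching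
-- multiple on the β side, and ζ_E(0, 1) = 1/2 identifies these with p = 0 and p = N + 1. The double
-- sum cannot supply them, since the alternating sum of (n + 1)^0 diverges. Two obstacles shape the
-- rest. A power (n + 1)^(-z) is known only as e^(-zl) for some l with e^l = n + 1; multiplicativity
-- of exp, obtained from a Cauchy product, turns this into an algebraic equation for its value u,
-- namely (n + 1)^m u = 1 for z = m and (n + 1) u^q = 1 for z = 1/q. And the order has no
-- trichotomy: weak inequality is a negation, bounds are two-sided, and the sign of a number is read
-- off from its invertibility.

-- Integer coefficients for the ring solver.

module IntegerSolver {a b} (R : CommutativeRing a b) where
  open CommutativeRing R
  open RingProperties ring
  open OptimisedMultiples semiring renaming (_×_ to _ℕ×_)
  open SetoidReasoning setoid

  -- With the optimised multiples, `fromℤ (+ 1)` reduces to `1#` itself. Hence `1-homo` is `refl`,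
  -- and `:1` in a solver goal stands for `1#` rather than for `1# + 0#`.
  fromℤ : ℤ → Carrier
  fromℤ (+ n)    = n ℕ× 1#
  fromℤ -[1+ n ] = - (suc n ℕ× 1#)

  fromℤ-⊖ : ∀ m n → fromℤ (m ⊖ n) ≈ m ℕ× 1# - n ℕ× 1#
  fromℤ-⊖ m       zero    = sym (trans (+-congˡ -0#≈0#) (+-identityʳ _))
  fromℤ-⊖ zero    (suc n) = sym (+-identityˡ _)
  fromℤ-⊖ (suc m) (suc n) = begin
    fromℤ (suc m ⊖ suc n)              ≡⟨ ≡.cong fromℤ (ℤₚ.[1+m]⊖[1+n]≡m⊖n m n) ⟩
    fromℤ (m ⊖ n)                      ≈⟨ fromℤ-⊖ m n ⟩
    m ℕ× 1# - n ℕ× 1#                  ≈⟨ +-congʳ (trans (+-congʳ (-‿inverseˡ 1#)) (+-identityˡ _)) ⟨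
    (- 1# + 1# + m ℕ× 1#) - n ℕ× 1#    ≈⟨ +-congʳ (+-assoc _ _ _) ⟩
    (- 1# + (1# + m ℕ× 1#)) - n ℕ× 1#  ≈⟨ +-congʳ (+-comm _ _) ⟩
    (1# + m ℕ× 1#) + - 1# - n ℕ× 1#    ≈⟨ +-assoc _ _ _ ⟩
    (1# + m ℕ× 1#) + (- 1# - n ℕ× 1#)  ≈⟨ +-congˡ (-‿+-comm 1# _) ⟩
    (1# + m ℕ× 1#) - (1# + n ℕ× 1#)    ≈⟨ +-cong (1+× m 1#) (-‿cong (1+× n 1#)) ⟨
    suc m ℕ× 1# - suc n ℕ× 1#          ∎

  fromℤ-neg : ∀ i → fromℤ (ℤ.- i) ≈ - fromℤ i
  fromℤ-neg (+ zero)  = sym -0#≈0#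
  fromℤ-neg (+ suc n) = refl
  fromℤ-neg -[1+ n ]  = sym (-‿involutive _)

  fromℤ-+ : ∀ i j → fromℤ (i ℤ.+ j) ≈ fromℤ i + fromℤ j
  fromℤ-+ (+ m)    (+ n)    = ×-homo-+ 1# m n
  fromℤ-+ (+ m)    -[1+ n ] = fromℤ-⊖ m (suc n)
  fromℤ-+ -[1+ m ] (+ n)    = trans (fromℤ-⊖ n (suc m)) (+-comm _ _)
  fromℤ-+ -[1+ m ] -[1+ n ] = begin
    - (suc (suc (m ℕ.+ n)) ℕ× 1#)      ≡⟨ ≡.cong (λ k → - (suc k ℕ× 1#)) (ℕₚ.+-suc m n) ⟨
    - ((suc m ℕ.+ suc n) ℕ× 1#)        ≈⟨ -‿cong (×-homo-+ 1# (suc m) (suc n)) ⟩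
    - (suc m ℕ× 1# + suc n ℕ× 1#)      ≈⟨ -‿+-comm _ _ ⟨
    - (suc m ℕ× 1#) + - (suc n ℕ× 1#)  ∎

  fromℤ-pos-* : ∀ m j → fromℤ (+ m ℤ.* j) ≈ m ℕ× 1# * fromℤ j
  fromℤ-pos-* m (+ n)    = trans (reflexive (≡.cong fromℤ (≡.sym (ℤₚ.pos-* m n)))) (×1-homo-* m n)
  fromℤ-pos-* m -[1+ n ] = begin
    fromℤ (+ m ℤ.* -[1+ n ])       ≡⟨ ≡.cong fromℤ (ℤₚ.neg-distribʳ-* (+ m) (+ suc n)) ⟨
    fromℤ (ℤ.- (+ m ℤ.* + suc n))  ≈⟨ fromℤ-neg (+ m ℤ.* + suc n) ⟩
    - fromℤ (+ m ℤ.* + suc n)      ≈⟨ -‿cong (fromℤ-pos-* m (+ suc n)) ⟩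
    - (m ℕ× 1# * (suc n ℕ× 1#))    ≈⟨ -‿distribʳ-* _ _ ⟩
    m ℕ× 1# * - (suc n ℕ× 1#)      ∎

  fromℤ-* : ∀ i j → fromℤ (i ℤ.* j) ≈ fromℤ i * fromℤ j
  fromℤ-* (+ m)    j = fromℤ-pos-* m j
  fromℤ-* -[1+ m ] j = begin
    fromℤ (-[1+ m ] ℤ.* j)       ≡⟨ ≡.cong fromℤ (ℤₚ.neg-distribˡ-* (+ suc m) j) ⟨
    fromℤ (ℤ.- (+ suc m ℤ.* j))  ≈⟨ fromℤ-neg (+ suc m ℤ.* j) ⟩
    - fromℤ (+ suc m ℤ.* j)      ≈⟨ -‿cong (fromℤ-pos-* (suc m) j) ⟩
    - (suc m ℕ× 1# * fromℤ j)    ≈⟨ -‿distribˡ-* _ _ ⟩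
    - (suc m ℕ× 1#) * fromℤ j    ∎

  morphism : ℤ.+-*-rawRing ACR.-Raw-AlmostCommutative⟶ ACR.fromCommutativeRing R
  morphism = record
    { ⟦_⟧    = fromℤ
    ; +-homo = fromℤ-+
    ; *-homo = fromℤ-*
    ; -‿homo = fromℤ-neg
    ; 0-homo = refl
    ; 1-homo = refl
    }

  _coeff≟_ : ∀ i j → Maybe (fromℤ i ≈ fromℤ j)
  i coeff≟ j = Maybe.map (λ p → reflexive (≡.cong fromℤ p)) (dec⇒maybe (i ℤₚ.≟ j))

  module Solver = Algebra.Solver.Ring ℤ.+-*-rawRing (ACR.fromCommutativeRing R) morphism _coeff≟_
  open Solver public using (_:=_; _:+_; _:*_; _:-_; :-_; con; Polynomial)
  open Solver using (⟦_⟧; ⟦_⟧N; ⟦_⟧N-cong; _≟N_; _≈N_; normalise; correct; var)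

  :1 : ∀ {n} → Polynomial n
  :1 = con (+ 1)

  -- The library's solve compares the semantics of normal forms in the carrier,
  -- which is slow when the ring is abstract; here the closed normal forms
  -- themselves are compared.
  prove : ∀ {n} (e₁ e₂ : Polynomial n) (m : Maybe (normalise e₁ ≈N normalise e₂)) → T (is-just m) →
          ∀ ρ → ⟦ e₁ ⟧ ρ ≈ ⟦ e₂ ⟧ ρ
  prove e₁ e₂ (just eq) _ ρ = trans (sym (correct e₁ ρ)) (trans (⟦ eq ⟧N-cong ρ) (correct e₂ ρ))

  -- Only the type of a solved identity matters later, so its large proof term is kept from
  -- unfolding. The implicit argument of type `T` is filled by eta once the normal forms agree.
  opaque
    solve : ∀ n (f : N-ary n (Polynomial n) (Polynomial n × Polynomial n)) →
      let e = f $ⁿ Vec.map var (allFin n) in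
      {T (is-just (normalise (proj₁ e) ≟N normalise (proj₂ e)))} →
      Eq n _≈_ (curryⁿ ⟦ proj₁ e ⟧) (curryⁿ ⟦ proj₂ e ⟧)
    solve n f {t} = let e = f $ⁿ Vec.map var (allFin n) in
      curryⁿ-cong _≈_ ⟦ proj₁ e ⟧ ⟦ proj₂ e ⟧ (prove (proj₁ e) (proj₂ e) _ t)

module Reciprocity {c ℓ₁ ℓ₂ ℓ₃ : Level} (R : RealField c ℓ₁ ℓ₂ ℓ₃) where
  open Analysis R
  open IntegerSolver commutativeRing using (solve; _:=_; _:+_; _:*_; _:-_; :-_; con; :1)
  open CommutativeRing commutativeRing using (commutativeSemiring)
  open CommutativeExp commutativeSemiring using (^-congˡ; ^-congʳ; ^-homo-*; ^-assocʳ; ^-distrib-*)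
  open Multiples semiring using (×-homo-+; ×1-homo-*)
  open RingProperties ring using (-0#≈0#; -‿involutive)
  open SetoidReasoning setoid
  open Sums semiring using (sum-cong-≋; ∑-distrib-+; ∑-comm; *-distribˡ-sum)

  -- Weak inequalities and two-sided bounds.

  infix 4 _≤_
  -- A disjunction of `_<_` and `_≈_` would be constructively too strong. The negation is closed
  -- under limits, and cotransitivity still lets it compose with `_<_`.
  _≤_ : ℝ → ℝ → Set ℓ₃
  x ≤ y = ¬ y < x

  <-≤-trans : ∀ {x y z} → x < y → y ≤ z → x < z
  <-≤-trans {z = z} x<y y≤z with <-cotrans x<y z
  ... | inj₁ x<z = x<z
  ... | inj₂ z<y = ⊥-elim (y≤z z<y)

  ≤-<-trans : ∀ {x y z} → x ≤ y → y < z → x < z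
  ≤-<-trans {x} x≤y y<z with <-cotrans y<z x
  ... | inj₁ y<x = ⊥-elim (x≤y y<x)
  ... | inj₂ x<z = x<z

  ≤-trans : ∀ {x y z} → x ≤ y → y ≤ z → x ≤ z
  ≤-trans x≤y y≤z z<x = y≤z (<-≤-trans z<x x≤y)

  <⇒≤ : ∀ {x y} → x < y → x ≤ y
  <⇒≤ x<y y<x = <-irrefl (<-trans x<y y<x)

  ≤-reflexive : ∀ {x y} → x ≈ y → x ≤ y
  ≤-reflexive x≈y y<x = <-irrefl (<-resp refl x≈y y<x)

  -- Tightness of the apartness: apart elements would be strictly ordered one way or the other, and
  -- both ways are refuted. This is the main route from estimates to equations.
  ≤-antisym : ∀ {x y} → x ≤ y → y ≤ x → x ≈ y
  ≤-antisym {x} {y} x≤y y≤x = proj₁ (tight x y) λ x#y → case (#⇒<⊎> x#y)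
    where
    case : x < y ⊎ y < x → _
    case (inj₁ x<y) = y≤x x<y
    case (inj₂ y<x) = x≤y y<x

  ≤-resp : ∀ {x x′ y y′} → x ≈ x′ → y ≈ y′ → x ≤ y → x′ ≤ y′
  ≤-resp p q x≤y y<x = x≤y (<-resp (sym q) (sym p) y<x)

  +-monoʳ-≤ : ∀ z {x y} → x ≤ y → z + x ≤ z + y
  +-monoʳ-≤ z x≤y p = x≤y (<-resp (cancel _) (cancel _) (+-monoʳ-< (- z) p))
    where
    cancel : ∀ x → - z + (z + x) ≈ x
    cancel = solve 2 (λ z x → :- z :+ (z :+ x) := x) z

  +-monoˡ-≤ : ∀ z {x y} → x ≤ y → x + z ≤ y + z
  +-monoˡ-≤ z x≤y = ≤-resp (+-comm _ _) (+-comm _ _) (+-monoʳ-≤ z x≤y)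

  +-mono-≤ : ∀ {x y u v} → x ≤ y → u ≤ v → x + u ≤ y + v
  +-mono-≤ p q = ≤-trans (+-monoˡ-≤ _ p) (+-monoʳ-≤ _ q)

  +-nonneg : ∀ {x y} → 0# ≤ x → 0# ≤ y → 0# ≤ x + y
  +-nonneg p q = ≤-resp (+-identityˡ 0#) refl (+-mono-≤ p q)

  ≤⇒0≤- : ∀ {x y} → x ≤ y → 0# ≤ y - x
  ≤⇒0≤- p = ≤-resp (-‿inverseʳ _) refl (+-monoˡ-≤ _ p)

  0≤-⇒≤ : ∀ {x y} → 0# ≤ y - x → x ≤ y
  0≤-⇒≤ p = ≤-resp (+-identityˡ _) (x-y+y _ _) (+-monoˡ-≤ _ p)

  -≤⇒≤+ : ∀ {x y z} → x - y ≤ z → x ≤ z + y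
  -≤⇒≤+ p = ≤-resp (x-y+y _ _) refl (+-monoˡ-≤ _ p)

  neg-mono-≤ : ∀ {x y} → x ≤ y → - y ≤ - x
  neg-mono-≤ {x} {y} p = 0≤-⇒≤ (≤-resp refl (solve 2 (λ x y → y :- x := :- x :- :- y) x y) (≤⇒0≤- p))

  x+x-nonneg : ∀ {x} → 0# ≤ x + x → 0# ≤ x
  x+x-nonneg p x<0 = p (<-resp refl (+-identityˡ 0#) (+-mono-< x<0 x<0))

  -- The signs of x and y cannot be decided in general. But if xy < 0, then xy is invertible, hence
  -- so are both factors; they are apart from 0 and their signs become decidable.
  *-nonneg : ∀ {x y} → 0# ≤ x → 0# ≤ y → 0# ≤ x * y
  *-nonneg {x} {y} 0≤x 0≤y xy<0 with recip (neg<0 xy<0)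
  ... | z , eq , _ = caseˣ (#⇒<⊎> (invertible⇒# x-inv))
    where
    unit : - (x * y) * z ≈ 1#
    unit = eq
    x-inv = - (y * z)
      , trans (solve 3 (λ x y z → :- (y :* z) :* (x :- con (+ 0)) := :- (x :* y) :* z) x y z) unit
      , trans (solve 3 (λ x y z → (x :- con (+ 0)) :* :- (y :* z) := :- (x :* y) :* z) x y z) unit
    y-inv = - (x * z)
      , trans (solve 3 (λ x y z → :- (x :* z) :* (y :- con (+ 0)) := :- (x :* y) :* z) x y z) unit
      , trans (solve 3 (λ x y z → (y :- con (+ 0)) :* :- (x :* z) := :- (x :* y) :* z) x y z) unit
    caseʸ : 0# < x → y < 0# ⊎ 0# < y → _
    caseʸ _   (inj₁ y<0) = 0≤y y<0
    caseʸ 0<x (inj₂ 0<y) = <-irrefl (<-trans xy<0 (*-pos 0<x 0<y))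
    caseˣ : x < 0# ⊎ 0# < x → _
    caseˣ (inj₁ x<0) = 0≤x x<0
    caseˣ (inj₂ 0<x) = caseʸ 0<x (#⇒<⊎> (invertible⇒# y-inv))

  *-monoʳ-≤ : ∀ {z x y} → 0# ≤ z → x ≤ y → z * x ≤ z * y
  *-monoʳ-≤ {z} {x} {y} 0≤z p = 0≤-⇒≤ (≤-resp refl
    (solve 3 (λ z x y → z :* (y :- x) := z :* y :- z :* x) z x y) (*-nonneg 0≤z (≤⇒0≤- p)))

  *-monoˡ-≤ : ∀ {z x y} → 0# ≤ z → x ≤ y → x * z ≤ y * z
  *-monoˡ-≤ 0≤z p = ≤-resp (*-comm _ _) (*-comm _ _) (*-monoʳ-≤ 0≤z p)

  *-mono-≤ : ∀ {x y u v} → 0# ≤ y → 0# ≤ u → x ≤ y → u ≤ v → x * u ≤ y * v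
  *-mono-≤ 0≤y 0≤u p q = ≤-trans (*-monoˡ-≤ 0≤u p) (*-monoʳ-≤ 0≤y q)

  *-cancelʳ-≤ : ∀ {x y z} → 0# < z → x * z ≤ y * z → x ≤ y
  *-cancelʳ-≤ 0<z p y<x = p (*-monoˡ-< 0<z y<x)

  -- A negative square excludes both x < 0 and 0 < x, so x is 0 by antisymmetry and its square is 0
  -- after all.
  square-nonneg : ∀ x → 0# ≤ x * x
  square-nonneg x xx<0 = <-irrefl (<-resp (trans (*-congʳ (≤-antisym x≤0 0≤x)) (zeroˡ x)) refl xx<0)
    where
    0≤x : 0# ≤ x
    0≤x x<0 = <-irrefl (<-trans (*-pos (neg<0 x<0) (neg<0 x<0))
      (<-resp (solve 1 (λ x → x :* x := :- x :* :- x) x) refl xx<0))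
    x≤0 : x ≤ 0#
    x≤0 0<x = <-irrefl (<-trans (*-pos 0<x 0<x) xx<0)

  1^ : ∀ n → 1# ^ n ≈ 1#
  1^ zero    = refl
  1^ (suc n) = trans (*-identityˡ _) (1^ n)

  ^-nonneg : ∀ {x} → 0# ≤ x → ∀ n → 0# ≤ x ^ n
  ^-nonneg 0≤x zero    = <⇒≤ 0<1
  ^-nonneg 0≤x (suc n) = *-nonneg 0≤x (^-nonneg 0≤x n)

  ^-≤1 : ∀ {x} → 0# ≤ x → x ≤ 1# → ∀ n → x ^ n ≤ 1#
  ^-≤1 0≤x x≤1 zero    = ≤-reflexive refl
  ^-≤1 0≤x x≤1 (suc n) = ≤-resp refl (*-identityˡ 1#)
    (*-mono-≤ (<⇒≤ 0<1) (^-nonneg 0≤x n) x≤1 (^-≤1 0≤x x≤1 n))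

  ^-cancel-≤ : ∀ {x y} → 0# < y → ∀ n → x ^ suc n ≤ y ^ suc n → x ≤ y
  ^-cancel-≤ 0<y n p y<x = p (^-mono-< 0<y y<x n)

  halve : ∀ {ε} → 0# < ε → ∃[ δ ] 0# < δ × δ + δ ≈ ε
  halve {ε} 0<ε with recip (+-pos 0<1 0<1)
  ... | ½ , 2*½ , 0<½ = ε * ½ , *-pos 0<ε 0<½ ,
    trans (solve 2 (λ e h → e :* h :+ e :* h := e :* ((:1 :+ :1) :* h)) ε ½)
          (trans (*-congˡ 2*½) (*-identityʳ ε))

  ε-≤ : ∀ {x y} → (∀ ε → 0# < ε → x ≤ y + ε) → x ≤ y
  ε-≤ {x} {y} h y<x with halve (<⇒0<- y<x)
  ... | δ , 0<δ , δ+δ = h δ 0<δ (<-resp refl eq (x<x+p 0<δ))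
    where
    eq : y + δ + δ ≈ x
    eq = trans (+-assoc _ _ _) (trans (+-congˡ δ+δ) (trans (+-comm _ _) (x-y+y x y)))

  infix 4 _within_
  -- The relation |x| ≤ b, stated without an absolute value.
  _within_ : ℝ → ℝ → Set ℓ₃
  x within b = x ≤ b × - x ≤ b

  within-resp : ∀ {x y b d} → x ≈ y → b ≈ d → x within b → y within d
  within-resp p q (h , k) = ≤-resp p q h , ≤-resp (-‿cong p) q k

  within-≤ : ∀ {x b d} → b ≤ d → x within b → x within d
  within-≤ p (h , k) = ≤-trans h p , ≤-trans k p

  within-0 : 0# within 0#
  within-0 = ≤-reflexive refl , ≤-reflexive -0#≈0#

  within-neg : ∀ {x b} → x within b → - x within b
  within-neg (h , k) = k , ≤-resp (sym (-‿involutive _)) refl h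

  nonneg⇒within : ∀ {x b} → 0# ≤ x → x ≤ b → x within b
  nonneg⇒within 0≤x x≤b = x≤b , ≤-trans (≤-resp refl -0#≈0# (neg-mono-≤ 0≤x)) (≤-trans 0≤x x≤b)

  within-+ : ∀ {x y b d} → x within b → y within d → x + y within b + d
  within-+ {x} {y} (h , k) (h′ , k′) = +-mono-≤ h h′
    , ≤-resp (solve 2 (λ x y → :- x :+ :- y := :- (x :+ y)) x y) refl (+-mono-≤ k k′)

  -- No case split on signs: 2(bd - xy) = (b - x)(d + y) + (b + x)(d - y), and 2(bd + xy) = (b -
  -- x)(d - y) + (b + x)(d + y), with all factors nonnegative.
  within-* : ∀ {x y b d} → x within b → y within d → x * y within b * d
  within-* {x} {y} {b} {d} (h , k) (h′ , k′) = 0≤-⇒≤ (x+x-nonneg (≤-resp refl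
      (solve 4 (λ x y b d → (b :- x) :* (d :- :- y) :+ (b :- :- x) :* (d :- y)
        := (b :* d :- x :* y) :+ (b :* d :- x :* y)) x y b d)
      (+-nonneg (*-nonneg (≤⇒0≤- h) (≤⇒0≤- k′)) (*-nonneg (≤⇒0≤- k) (≤⇒0≤- h′)))))
    , 0≤-⇒≤ (x+x-nonneg (≤-resp refl
      (solve 4 (λ x y b d → (b :- x) :* (d :- y) :+ (b :- :- x) :* (d :- :- y)
        := (b :* d :- :- (x :* y)) :+ (b :* d :- :- (x :* y))) x y b d)
      (+-nonneg (*-nonneg (≤⇒0≤- h) (≤⇒0≤- h′)) (*-nonneg (≤⇒0≤- k) (≤⇒0≤- k′)))))

  within-^ : ∀ {x b} → x within b → ∀ n → x ^ n within b ^ n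
  within-^ w zero    = nonneg⇒within (<⇒≤ 0<1) (≤-reflexive refl)
  within-^ w (suc n) = within-* w (within-^ w n)

  square-within : ∀ {x b} → 0# ≤ b → x * x ≤ b * b → x within b
  square-within {x} {b} 0≤b p = below p
    , below (≤-resp (solve 1 (λ x → x :* x := :- x :* :- x) x) refl p)
    where
    below : ∀ {x} → x * x ≤ b * b → x ≤ b
    below p b<x = p (≤-<-trans (*-monoʳ-≤ 0≤b (<⇒≤ b<x)) (*-monoˡ-< (≤-<-trans 0≤b b<x) b<x))

  sign-within : ∀ n → sign n within 1#
  sign-within n = within-resp refl (1^ n) (within-^ (within-neg (nonneg⇒within (<⇒≤ 0<1) (≤-reflexive refl))) n)

  -- Limits

  -- The bounds in Null are closed, which makes them stable under the order
  -- operations; _⟶_ itself is recovered by halving ε.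

  Eventually : (ℕ → Set ℓ₃) → Set ℓ₃
  Eventually P = ∃[ M ] (∀ n → M ℕ.≤ n → P n)

  Eventually-× : ∀ {P Q} → Eventually P → Eventually Q → Eventually (λ n → P n × Q n)
  Eventually-× (M , p) (N , q) = M ℕ.⊔ N , λ n h →
    p n (ℕₚ.≤-trans (ℕₚ.m≤m⊔n M N) h) , q n (ℕₚ.≤-trans (ℕₚ.m≤n⊔m M N) h)

  Eventually-map : ∀ {P Q : ℕ → Set ℓ₃} → (∀ n → P n → Q n) → Eventually P → Eventually Q
  Eventually-map f (M , p) = M , λ n h → f n (p n h)

  Null : (ℕ → ℝ) → Set (c ⊔ ℓ₃)
  Null u = ∀ ε → 0# < ε → Eventually (λ n → u n within ε)

  Near⇒within : ∀ {ε x y} → Near ε x y → x - y within ε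
  Near⇒within {x = x} {y} (p , q) = <⇒≤ p
    , <⇒≤ (<-resp (solve 2 (λ x y → y :- x := :- (x :- y)) x y) refl q)

  within⇒Near : ∀ {δ ε x y} → δ < ε → x - y within δ → Near ε x y
  within⇒Near {x = x} {y} δ<ε (p , q) = ≤-<-trans p δ<ε
    , ≤-<-trans (≤-resp (solve 2 (λ x y → :- (x :- y) := y :- x) x y) refl q) δ<ε

  half< : ∀ {δ ε} → 0# < δ → δ + δ ≈ ε → δ < ε
  half< 0<δ eq = <-resp refl eq (x<x+p 0<δ)

  ⟶⇒Null : ∀ {u l} → u ⟶ l → Null (λ n → u n - l)
  ⟶⇒Null h ε 0<ε = Eventually-map (λ n → Near⇒within) (h ε 0<ε)

  Null⇒⟶ : ∀ {u l} → Null (λ n → u n - l) → u ⟶ l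
  Null⇒⟶ h ε 0<ε with halve 0<ε
  ... | δ , 0<δ , eq with h δ 0<δ
  ... | M , k = M , λ n M≤n → within⇒Near (half< 0<δ eq) (k n M≤n)

  Null-resp : ∀ {u v} → (∀ n → u n ≈ v n) → Null u → Null v
  Null-resp eq h ε 0<ε = Eventually-map (λ n → within-resp (eq n) refl) (h ε 0<ε)

  Null-squeeze : ∀ {u v} → (∀ n → u n within v n) → Null v → Null u
  Null-squeeze eq h ε 0<ε = Eventually-map (λ n w → within-≤ (proj₁ w) (eq n)) (h ε 0<ε)

  Null-+ : ∀ {u v} → Null u → Null v → Null (λ n → u n + v n)
  Null-+ h k ε 0<ε with halve 0<ε
  ... | δ , 0<δ , eq = Eventually-map (λ n (p , q) → within-resp refl eq (within-+ p q))
                                      (Eventually-× (h δ 0<δ) (k δ 0<δ))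

  Null-*-bounded : ∀ {u v : ℕ → ℝ} {b : ℝ} → 0# < b → (∀ n → v n within b) → Null u → Null (λ n → u n * v n)
  Null-*-bounded {b = b} 0<b vb h ε 0<ε with recip 0<b
  ... | y , b*y , 0<y = Eventually-map (λ n p → within-resp refl
      (trans (*-assoc ε y b) (trans (*-congˡ (trans (*-comm y b) b*y)) (*-identityʳ ε))) (within-* p (vb n)))
    (h (ε * y) (*-pos 0<ε 0<y))

  below-1+square : ∀ x → x ≤ 1# + x * x
  below-1+square x = 0≤-⇒≤ (x+x-nonneg (≤-resp refl
    (solve 1 (λ x → (:1 :- x) :* (:1 :- x) :+ (:1 :+ x :* x)
      := ((:1 :+ x :* x) :- x) :+ ((:1 :+ x :* x) :- x)) x)
    (+-nonneg (square-nonneg (1# - x)) (+-nonneg (<⇒≤ 0<1) (square-nonneg x)))))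

  -- The polynomial 1 + x² takes the place of max(1, |x|). It dominates x because 2(1 + x² - x) = (1
  -- - x)² + 1 + x².
  bound : ∀ x → ∃[ b ] 0# < b × x within b
  bound x = 1# + x * x
    , <-≤-trans 0<1 (≤-resp (+-identityʳ 1#) refl (+-monoʳ-≤ 1# (square-nonneg x)))
    , below-1+square x
    , ≤-resp refl (solve 1 (λ x → :1 :+ :- x :* :- x := :1 :+ x :* x) x) (below-1+square (- x))

  Null-*ʳ : ∀ {u} b → Null u → Null (λ n → u n * b)
  Null-*ʳ b h with bound b
  ... | d , 0<d , w = Null-*-bounded {v = λ _ → b} 0<d (λ _ → w) h

  Null-neg : ∀ {u} → Null u → Null (λ n → - u n)
  Null-neg h ε 0<ε = Eventually-map (λ n → within-neg) (h ε 0<ε)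

  Null-* : ∀ {u v} → Null u → Null v → Null (λ n → u n * v n)
  Null-* h k ε 0<ε = Eventually-map (λ n (p , q) → within-resp refl (*-identityʳ ε) (within-* p q))
                                    (Eventually-× (h ε 0<ε) (k 1# 0<1))

  ⟶-resp : ∀ {u v l m} → (∀ n → u n ≈ v n) → l ≈ m → u ⟶ l → v ⟶ m
  ⟶-resp p q h = Null⇒⟶ (Null-resp (λ n → +-cong (p n) (-‿cong q)) (⟶⇒Null h))

  ⟶-const : ∀ {x} → (λ _ → x) ⟶ x
  ⟶-const {x} = Null⇒⟶ (λ ε 0<ε → 0 , λ n _ →
    within-≤ (<⇒≤ 0<ε) (within-resp (sym (-‿inverseʳ x)) refl within-0))

  ⟶-+ : ∀ {u v l m} → u ⟶ l → v ⟶ m → (λ n → u n + v n) ⟶ (l + m)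
  ⟶-+ {u} {v} {l} {m} h k = Null⇒⟶ (Null-resp (λ n →
    solve 4 (λ u v l m → (u :- l) :+ (v :- m) := (u :+ v) :- (l :+ m)) (u n) (v n) l m)
    (Null-+ (⟶⇒Null h) (⟶⇒Null k)))

  ⟶-neg : ∀ {u l} → u ⟶ l → (λ n → - u n) ⟶ (- l)
  ⟶-neg {u} {l} h = Null⇒⟶ (Null-resp (λ n →
    solve 2 (λ u l → :- (u :- l) := :- u :- :- l) (u n) l) (Null-neg (⟶⇒Null h)))

  ⟶-* : ∀ {u v l m} → u ⟶ l → v ⟶ m → (λ n → u n * v n) ⟶ (l * m)
  ⟶-* {u} {v} {l} {m} h k = Null⇒⟶ (Null-resp (λ n →
    solve 4 (λ u v l m → ((u :- l) :* (v :- m) :+ (u :- l) :* m) :+ (v :- m) :* l := u :* v :- l :* m) (u n) (v n) l m)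
    (Null-+ (Null-+ (Null-* (⟶⇒Null h) (⟶⇒Null k)) (Null-*ʳ m (⟶⇒Null h))) (Null-*ʳ l (⟶⇒Null k))))

  ⟶-*ˡ : ∀ {u l} b → u ⟶ l → (λ n → b * u n) ⟶ (b * l)
  ⟶-*ˡ b h = ⟶-* ⟶-const h

  ⟶-shift : ∀ {u l} m → u ⟶ l → (λ n → u (m ℕ.+ n)) ⟶ l
  ⟶-shift m h ε 0<ε with h ε 0<ε
  ... | M , p = M , λ n M≤n → p (m ℕ.+ n) (ℕₚ.≤-trans M≤n (ℕₚ.m≤n+m n m))

  ⟶-nonneg : ∀ {u l} → (∀ n → 0# ≤ u n) → u ⟶ l → 0# ≤ l
  ⟶-nonneg {u} {l} p h = ε-≤ λ ε 0<ε → let M , k = ⟶⇒Null h ε 0<ε in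
    ≤-trans (p M) (≤-resp refl (+-comm _ _) (-≤⇒≤+ (proj₁ (k M ℕₚ.≤-refl))))

  ⟶-≤ : ∀ {u l b} → (∀ n → u n ≤ b) → u ⟶ l → l ≤ b
  ⟶-≤ p h = 0≤-⇒≤ (⟶-nonneg (λ n → ≤⇒0≤- (p n)) (⟶-+ ⟶-const (⟶-neg h)))

  ⟶-within : ∀ {u l b} → (∀ n → u n within b) → u ⟶ l → l within b
  ⟶-within p h = ⟶-≤ (λ n → proj₁ (p n)) h , ⟶-≤ (λ n → proj₂ (p n)) (⟶-neg h)

  Null-const : ∀ {x} → Null (λ _ → x) → x ≈ 0#
  Null-const {x} h = ≤-antisym (below (λ ε 0<ε → proj₁ (at ε 0<ε))) (≤-resp -0#≈0# (-‿involutive x)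
    (neg-mono-≤ (below (λ ε 0<ε → proj₂ (at ε 0<ε)))))
    where
    at : ∀ ε → 0# < ε → x within ε
    at ε 0<ε = let M , k = h ε 0<ε in k M ℕₚ.≤-refl
    below : ∀ {x} → (∀ ε → 0# < ε → x ≤ ε) → x ≤ 0#
    below p = ε-≤ λ ε 0<ε → ≤-resp refl (sym (+-identityˡ ε)) (p ε 0<ε)

  ⟶-unique : ∀ {u l m} → u ⟶ l → u ⟶ m → l ≈ m
  ⟶-unique {u} {l} {m} h k = trans (sym (x-y+y l m)) (trans (+-congʳ (Null-const
    (Null-resp (λ n → solve 3 (λ u l m → (u :- m) :+ :- (u :- l) := l :- m) (u n) l m)
    (Null-+ (⟶⇒Null k) (Null-neg (⟶⇒Null h)))))) (+-identityˡ m))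

  -- Finite sums.

  Σ-cong : ∀ {f g : ℕ → ℝ} → (∀ i → f i ≈ g i) → ∀ n → partialSum f n ≈ partialSum g n
  Σ-cong eq n = sum-cong-≋ {n} (λ i → eq (toℕ i))

  Σ-cong-< : ∀ {f g : ℕ → ℝ} n → (∀ i → i ℕ.< n → f i ≈ g i) → partialSum f n ≈ partialSum g n
  Σ-cong-< zero    eq = refl
  Σ-cong-< (suc n) eq = +-cong (eq 0 ℕ.z<s) (Σ-cong-< n (λ i i<n → eq (suc i) (ℕ.s<s i<n)))

  Σ-+ : ∀ (f g : ℕ → ℝ) n → partialSum (λ i → f i + g i) n ≈ partialSum f n + partialSum g n
  Σ-+ f g n = ∑-distrib-+ {n} (λ i → f (toℕ i)) (λ i → g (toℕ i))

  Σ-*ˡ : ∀ x (f : ℕ → ℝ) n → x * partialSum f n ≈ partialSum (λ i → x * f i) n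
  Σ-*ˡ x f n = *-distribˡ-sum {n} x (λ i → f (toℕ i))

  Σ-*ʳ : ∀ x (f : ℕ → ℝ) n → partialSum f n * x ≈ partialSum (λ i → f i * x) n
  Σ-*ʳ x f n = trans (*-comm _ _) (trans (Σ-*ˡ x f n) (Σ-cong (λ i → *-comm x (f i)) n))

  Σ-neg : ∀ (f : ℕ → ℝ) n → - partialSum f n ≈ partialSum (λ i → - f i) n
  Σ-neg f n = sym (sum-neg (λ i → - f i) f (λ i → refl) n)

  Σ-comm : ∀ (f : ℕ → ℕ → ℝ) m n → partialSum (λ i → partialSum (f i) n) m
                                 ≈ partialSum (λ j → partialSum (λ i → f i j) m) n
  Σ-comm f m n = ∑-comm {m} {n} (λ i j → f (toℕ i) (toℕ j))

  Σ-snoc : ∀ (f : ℕ → ℝ) n → partialSum f (suc n) ≈ partialSum f n + f n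
  Σ-snoc f zero    = +-comm _ _
  Σ-snoc f (suc n) = trans (+-congˡ (Σ-snoc (λ i → f (suc i)) n)) (sym (+-assoc _ _ _))

  Σ-const : ∀ x n → partialSum (λ _ → x) n ≈ n ℕ× 1# * x
  Σ-const x zero    = sym (zeroˡ x)
  Σ-const x (suc n) = trans (+-congˡ (Σ-const x n))
    (trans (+-congʳ (sym (*-identityˡ x))) (sym (distribʳ x 1# (n ℕ× 1#))))

  Σ-within : ∀ {f g : ℕ → ℝ} n → (∀ i → i ℕ.< n → f i within g i) → partialSum f n within partialSum g n
  Σ-within zero    w = within-0
  Σ-within (suc n) w = within-+ (w 0 ℕ.z<s) (Σ-within n (λ i i<n → w (suc i) (ℕ.s<s i<n)))

  HasSum-resp : ∀ {f g : ℕ → ℝ} {s t} → (∀ i → f i ≈ g i) → s ≈ t → HasSum f s → HasSum g t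
  HasSum-resp p q = ⟶-resp (Σ-cong p) q

  -- Alternating and telescoping series.

  -- Assumes weak monotonicity only, unlike `IsLeibniz`, because the differences of a convex
  -- sequence are only known to decrease weakly.
  alternating-bounds : ∀ (a : ℕ → ℝ) → (∀ n → 0# ≤ a n) → (∀ n → a (suc n) ≤ a n) → ∀ n →
    0# ≤ partialSum (alternating a) n × partialSum (alternating a) n ≤ a 0
  alternating-bounds a p d zero    = ≤-reflexive refl , p 0
  alternating-bounds a p d (suc n) =
      ≤-resp refl (sym (unfold a n)) (≤⇒0≤- (≤-trans (proj₂ ih) (d 0)))
    , ≤-resp (sym (unfold a n)) (trans (+-congˡ -0#≈0#) (+-identityʳ _))
        (+-monoʳ-≤ (a 0) (neg-mono-≤ (proj₁ ih)))
    where ih = alternating-bounds (λ i → a (suc i)) (λ i → p (suc i)) (λ i → d (suc i)) n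

  alternating-tail : ∀ (a : ℕ → ℝ) → (∀ n → 0# ≤ a n) → (∀ n → a (suc n) ≤ a n) → ∀ M n →
    partialSum (alternating a) (M ℕ.+ n) - partialSum (alternating a) M within a M
  alternating-tail a p d zero n = within-resp (sym (trans (+-congˡ -0#≈0#) (+-identityʳ _))) refl
    (nonneg⇒within (proj₁ b) (proj₂ b))
    where b = alternating-bounds a p d n
  alternating-tail a p d (suc M) n = within-resp
    (trans (solve 3 (λ x y z → :- (y :- z) := (x :- y) :- (x :- z)) (a 0) _ _)
           (sym (+-cong (unfold a (M ℕ.+ n)) (-‿cong (unfold a M)))))
    refl
    (within-neg (alternating-tail (λ i → a (suc i)) (λ i → p (suc i)) (λ i → d (suc i)) M n))

  alternating-remainder : ∀ {a : ℕ → ℝ} {s} → (∀ n → 0# ≤ a n) → (∀ n → a (suc n) ≤ a n) →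
    HasSum (alternating a) s → ∀ M → s - partialSum (alternating a) M within a M
  alternating-remainder p d h M = ⟶-within (alternating-tail _ p d M)
    (⟶-+ (⟶-shift M h) ⟶-const)

  -- A comparison test whose majorant is a telescoping difference, so that tails are bounded by `G`
  -- in closed form. It serves both the geometric series and the sum of 1/n².
  telescope-within : ∀ {f : ℕ → ℝ} (G : ℕ → ℝ) → (∀ i → f i within G i - G (suc i)) → ∀ M n →
    partialSum f (M ℕ.+ n) - partialSum f M within G M - G (M ℕ.+ n)
  telescope-within {f} G w zero zero = within-resp (sym (-‿inverseʳ 0#)) (sym (-‿inverseʳ (G 0))) within-0
  telescope-within {f} G w zero (suc n) = within-resp
    (solve 2 (λ x y → x :+ (y :- con (+ 0)) := (x :+ y) :- con (+ 0)) (f 0) (partialSum (λ i → f (suc i)) n))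
    (solve 3 (λ x y z → (x :- y) :+ (y :- z) := x :- z) (G 0) (G 1) (G (suc n)))
    (within-+ (w 0) (telescope-within (λ i → G (suc i)) (λ i → w (suc i)) zero n))
  telescope-within {f} G w (suc M) n = within-resp
    (solve 3 (λ x y z → y :- z := (x :+ y) :- (x :+ z)) (f 0)
      (partialSum (λ i → f (suc i)) (M ℕ.+ n)) (partialSum (λ i → f (suc i)) M)) refl
    (telescope-within (λ i → G (suc i)) (λ i → w (suc i)) M n)

  telescope-tail : ∀ {f : ℕ → ℝ} (G : ℕ → ℝ) → (∀ i → 0# ≤ G i) → (∀ i → f i within G i - G (suc i)) → ∀ M {n} →
    M ℕ.≤ n → partialSum f n - partialSum f M within G M
  telescope-tail {f} G p w M {n} M≤n = ≡.subst (λ n → partialSum f n - partialSum f M within G M)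
    (ℕₚ.m+[n∸m]≡n M≤n)
    (within-≤ (≤-resp refl (trans (+-congˡ -0#≈0#) (+-identityʳ _)) (+-monoʳ-≤ (G M) (neg-mono-≤ (p (M ℕ.+ (n ℕ.∸ M))))))
      (telescope-within G w M (n ℕ.∸ M)))

  telescope-summable : ∀ {f : ℕ → ℝ} (G : ℕ → ℝ) → (∀ i → 0# ≤ G i) → Null G → (∀ i → f i within G i - G (suc i)) →
    ∃[ s ] HasSum f s
  telescope-summable {f} G p null w = complete (partialSum f) cauchy
    where
    cauchy : IsCauchy (partialSum f)
    cauchy ε 0<ε with halve 0<ε
    -- Halved twice: once to pass from weak to strict inequality, once because both partial sums are
    -- compared with the one of length M.
    ... | δ , 0<δ , δ+δ with halve 0<δ
    ... | η , 0<η , η+η with null η 0<η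
    ... | M , k = M , λ m n M≤m M≤n → within⇒Near (half< 0<δ δ+δ) (within-resp
        (solve 3 (λ x y z → (x :- z) :+ :- (y :- z) := x :- y) (partialSum f m) (partialSum f n) (partialSum f M)) η+η
        (within-+ (small M≤m) (within-neg (small M≤n))))
      where
      small : ∀ {m} → M ℕ.≤ m → partialSum f m - partialSum f M within η
      small M≤m = within-≤ (proj₁ (k M ℕₚ.≤-refl)) (telescope-tail G p w M M≤m)

  -- The numbers n + 1 and their reciprocals.

  ν r : ℕ → ℝ
  ν n = val (shift n 1⁺)
  r n = val (shift n 1⁺ ⁻¹)

  ν*r : ∀ n → ν n * r n ≈ 1#
  ν*r n = *-inverseʳ (shift n 1⁺)

  0<ν : ∀ n → 0# < ν n
  0<ν n = pos (shift n 1⁺)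

  0<r : ∀ n → 0# < r n
  0<r n = pos (shift n 1⁺ ⁻¹)

  ν≈ : ∀ n → ν n ≈ suc n ℕ× 1#
  ν≈ n = +-comm _ _

  ν-suc : ∀ n → ν (suc n) ≈ 1# + ν n
  ν-suc n = +-assoc _ _ _

  1≤ν : ∀ n → 1# ≤ ν n
  1≤ν zero    = ≤-reflexive (sym (+-identityˡ 1#))
  1≤ν (suc n) = ≤-trans (1≤ν n) (<⇒≤ (shift-< n 1⁺))

  r≤1 : ∀ n → r n ≤ 1#
  r≤1 n = ≤-resp (*-identityˡ _) (ν*r n) (*-monoˡ-≤ (<⇒≤ (0<r n)) (1≤ν n))

  r-decreasing : ∀ n → r (suc n) ≤ r n
  r-decreasing n = <⇒≤ (⁻¹-anti (shift n 1⁺) (shift (suc n) 1⁺) (shift-< n 1⁺))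

  antitone-≤ : ∀ {a : ℕ → ℝ} → (∀ n → a (suc n) ≤ a n) → ∀ m n → a (m ℕ.+ n) ≤ a m
  antitone-≤ d zero    zero    = ≤-reflexive refl
  antitone-≤ d zero    (suc n) = ≤-trans (d n) (antitone-≤ d zero n)
  antitone-≤ d (suc m) n       = antitone-≤ (λ i → d (suc i)) m n

  antitone-Null : ∀ {a : ℕ → ℝ} → (∀ n → 0# ≤ a n) → (∀ n → a (suc n) ≤ a n) →
    (∀ ε → 0# < ε → ∃[ n ] a n < ε) → Null a
  antitone-Null {a} p d h ε 0<ε with h ε 0<ε
  ... | M , q = M , λ n M≤n → nonneg⇒within (p n)
    (≤-trans (≡.subst (λ n → a n ≤ a M) (ℕₚ.m+[n∸m]≡n M≤n) (antitone-≤ d M (n ℕ.∸ M))) (<⇒≤ q))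

  r-Null : Null r
  r-Null = antitone-Null (λ n → <⇒≤ (0<r n)) r-decreasing small
    where
    small : ∀ ε → 0# < ε → ∃[ n ] r n < ε
    small ε 0<ε with shift-unbounded (val ((ε ,⁺ 0<ε) ⁻¹)) (pos ((ε ,⁺ 0<ε) ⁻¹)) 1⁺
    ... | n , _ , b = n , ⁻¹-flip (ε ,⁺ 0<ε) (shift n 1⁺) b

  ℕ×-nonneg : ∀ n → 0# ≤ n ℕ× 1#
  ℕ×-nonneg zero    = ≤-reflexive refl
  ℕ×-nonneg (suc n) = +-nonneg (<⇒≤ 0<1) (ℕ×-nonneg n)

  ℕ×≤ν : ∀ n → n ℕ× 1# ≤ ν n
  ℕ×≤ν n = <⇒≤ (x<x+p 0<1)

  ν-cancelˡ : ∀ n {x y} → ν n * x ≈ ν n * y → x ≈ y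
  ν-cancelˡ n {x} {y} eq = trans (sym (unit x)) (trans (*-congˡ eq) (unit y))
    where
    unit : ∀ x → r n * (ν n * x) ≈ x
    unit x = trans (sym (*-assoc _ _ _)) (trans (*-congʳ (trans (*-comm _ _) (ν*r n))) (*-identityˡ x))

  -- The exponential function

  conv : (f g : ℕ → ℝ) → ℕ → ℝ
  conv f g n = partialSum (λ i → f i * g (n ℕ.∸ i)) (suc n)

  conv-snoc : ∀ (f g : ℕ → ℝ) n → conv f g (suc n) ≈ conv f (λ j → g (suc j)) n + f (suc n) * g 0
  conv-snoc f g zero    = solve 2 (λ x y → x :+ (y :+ con (+ 0)) := (x :+ con (+ 0)) :+ y) (f 0 * g 1) (f 1 * g 0)
  conv-snoc f g (suc n) = trans (+-congˡ (conv-snoc (λ i → f (suc i)) g n)) (sym (+-assoc _ _ _))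

  -- Both sides sum f i * g j over the triangle i + j < n; the induction peels off the column of
  -- `f 0`.
  Σ-conv : ∀ (f g : ℕ → ℝ) n → partialSum (conv f g) n ≈ partialSum (λ i → f i * partialSum g (n ℕ.∸ i)) n
  Σ-conv f g zero    = refl
  Σ-conv f g (suc n) = begin
    conv f g 0 + partialSum (λ i → f 0 * g (suc i) + conv f′ g i) n
      ≈⟨ +-cong (+-identityʳ _) (Σ-+ (λ i → f 0 * g (suc i)) (conv f′ g) n) ⟩
    f 0 * g 0 + (partialSum (λ i → f 0 * g (suc i)) n + partialSum (conv f′ g) n)
      ≈⟨ +-congˡ (+-cong (sym (Σ-*ˡ (f 0) (λ i → g (suc i)) n)) (Σ-conv f′ g n)) ⟩
    f 0 * g 0 + (f 0 * partialSum (λ i → g (suc i)) n + rest)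
      ≈⟨ solve 4 (λ a x y z → a :* x :+ (a :* y :+ z) := a :* (x :+ y) :+ z) (f 0) (g 0) _ rest ⟩
    f 0 * partialSum g (suc n) + rest ∎
    where
    f′ = λ i → f (suc i)
    rest = partialSum (λ i → f′ i * partialSum g (n ℕ.∸ i)) n

  conv-scaleˡ : ∀ x (f g : ℕ → ℝ) n → conv (λ i → x * f i) g n ≈ x * conv f g n
  conv-scaleˡ x f g n = trans (Σ-cong (λ i → *-assoc x (f i) (g (n ℕ.∸ i))) (suc n))
    (sym (Σ-*ˡ x (λ i → f i * g (n ℕ.∸ i)) (suc n)))

  conv-scaleʳ : ∀ x (f g : ℕ → ℝ) n → conv f (λ i → x * g i) n ≈ x * conv f g n
  conv-scaleʳ x f g n = trans
    (Σ-cong (λ i → solve 3 (λ f x g → f :* (x :* g) := x :* (f :* g)) (f i) x (g (n ℕ.∸ i))) (suc n))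
    (sym (Σ-*ˡ x (λ i → f i * g (n ℕ.∸ i)) (suc n)))

  conv-congˡ : ∀ {f f′ : ℕ → ℝ} (g : ℕ → ℝ) → (∀ i → f i ≈ f′ i) → ∀ n → conv f g n ≈ conv f′ g n
  conv-congˡ {f} {f′} g p n =
    Σ-cong {λ i → f i * g (n ℕ.∸ i)} {λ i → f′ i * g (n ℕ.∸ i)} (λ i → *-congʳ (p i)) (suc n)

  conv-congʳ : ∀ (f : ℕ → ℝ) {g g′ : ℕ → ℝ} → (∀ i → g i ≈ g′ i) → ∀ n → conv f g n ≈ conv f g′ n
  conv-congʳ f {g} {g′} p n =
    Σ-cong {λ i → f i * g (n ℕ.∸ i)} {λ i → f i * g′ (n ℕ.∸ i)} (λ i → *-congˡ (p (n ℕ.∸ i))) (suc n)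

  -- The operator x d/dx on coefficient sequences of power series; `D-conv` is its product rule,
  -- from n = i + (n - i).
  D : (ℕ → ℝ) → ℕ → ℝ
  D f n = n ℕ× 1# * f n

  D-conv : ∀ (f g : ℕ → ℝ) n → D (conv f g) n ≈ conv (D f) g n + conv f (D g) n
  D-conv f g n = begin
    n ℕ× 1# * conv f g n
      ≈⟨ Σ-*ˡ (n ℕ× 1#) (λ i → f i * g (n ℕ.∸ i)) (suc n) ⟩
    partialSum (λ i → n ℕ× 1# * (f i * g (n ℕ.∸ i))) (suc n)
      ≈⟨ Σ-cong-< (suc n) split ⟩
    partialSum (λ i → D f i * g (n ℕ.∸ i) + f i * D g (n ℕ.∸ i)) (suc n)
      ≈⟨ Σ-+ (λ i → D f i * g (n ℕ.∸ i)) (λ i → f i * D g (n ℕ.∸ i)) (suc n) ⟩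
    conv (D f) g n + conv f (D g) n ∎
    where
    split : ∀ i → i ℕ.< suc n → n ℕ× 1# * (f i * g (n ℕ.∸ i)) ≈ D f i * g (n ℕ.∸ i) + f i * D g (n ℕ.∸ i)
    split i (ℕ.s≤s i≤n) = trans
      (*-congʳ (trans (reflexive (≡.cong (_ℕ× 1#) (≡.sym (ℕₚ.m+[n∸m]≡n i≤n)))) (×-homo-+ 1# i (n ℕ.∸ i))))
      (solve 4 (λ x y f g → (x :+ y) :* (f :* g) := x :* f :* g :+ f :* (y :* g))
        (i ℕ× 1#) ((n ℕ.∸ i) ℕ× 1#) (f i) (g (n ℕ.∸ i)))

  val-fromℕ⁺ : ∀ n .{{_ : NonZero n}} → val (fromℕ⁺ n) ≈ n ℕ× 1#
  val-fromℕ⁺ (suc n) = ν≈ n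

  expTerm : ℝ → ℕ → ℝ
  expTerm x n = val (factorial⁺ n ⁻¹) * x ^ n

  expTerm-0 : ∀ x → expTerm x 0 ≈ 1#
  expTerm-0 x = trans (*-identityʳ _) (trans (sym (*-identityˡ _)) (trans (*-congʳ (sym (+-identityˡ 1#))) (ν*r 0)))

  val-factorial : ∀ n → val (factorial⁺ (suc n)) ≈ ν n * val (factorial⁺ n)
  val-factorial n = begin
    val (factorial⁺ (suc n))            ≈⟨ val-fromℕ⁺ (suc n !) {{suc n ℕₚ.!≢0}} ⟩
    (suc n ℕ.* n !) ℕ× 1#               ≈⟨ ×1-homo-* (suc n) (n !) ⟩
    suc n ℕ× 1# * ((n !) ℕ× 1#)           ≈⟨ *-cong (ν≈ n) (val-fromℕ⁺ (n !) {{n ℕₚ.!≢0}}) ⟨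
    ν n * val (factorial⁺ n)            ∎

  expTerm-suc : ∀ x n → ν n * expTerm x (suc n) ≈ x * expTerm x n
  expTerm-suc x n = begin
    ν n * (h * (x * p))                  ≈⟨ *-identityʳ _ ⟨
    ν n * (h * (x * p)) * 1#             ≈⟨ *-congˡ (*-inverseʳ (factorial⁺ n)) ⟨
    ν n * (h * (x * p)) * (m * i)        ≈⟨ solve 6 (λ n h x p m i → n :* (h :* (x :* p)) :* (m :* i) := x :* (i :* p) :* ((n :* m) :* h)) (ν n) h x p m i ⟩
    x * (i * p) * ((ν n * m) * h)        ≈⟨ *-congˡ (*-congʳ (val-factorial n)) ⟨
    x * (i * p) * (val (factorial⁺ (suc n)) * h)  ≈⟨ *-congˡ (*-inverseʳ (factorial⁺ (suc n))) ⟩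
    x * (i * p) * 1#                     ≈⟨ *-identityʳ _ ⟩
    x * (i * p)                          ∎
    where
    h = val (factorial⁺ (suc n) ⁻¹)
    m = val (factorial⁺ n)
    i = val (factorial⁺ n ⁻¹)
    p = x ^ n

  D-expTerm : ∀ x n → D (expTerm x) (suc n) ≈ x * expTerm x n
  D-expTerm x n = trans (*-congʳ (sym (ν≈ n))) (expTerm-suc x n)

  -- The binomial theorem without binomial coefficients. Both sides satisfy (n + 1) c(n + 1) = (x +
  -- y) c(n), the left one because `D` is a derivation, and n + 1 can be cancelled.
  expTerm-+ : ∀ x y n → conv (expTerm x) (expTerm y) n ≈ expTerm (x + y) n
  expTerm-+ x y zero    = trans (+-identityʳ _) (trans (*-cong (expTerm-0 x) (expTerm-0 y))
    (trans (*-identityˡ 1#) (sym (expTerm-0 (x + y)))))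
  expTerm-+ x y (suc n) = ν-cancelˡ n (begin
    ν n * conv a b (suc n)                        ≈⟨ *-congʳ (ν≈ n) ⟩
    D (conv a b) (suc n)                          ≈⟨ D-conv a b (suc n) ⟩
    conv (D a) b (suc n) + conv a (D b) (suc n)   ≈⟨ +-cong left right ⟩
    x * conv a b n + y * conv a b n               ≈⟨ distribʳ _ x y ⟨
    (x + y) * conv a b n                          ≈⟨ *-congˡ (expTerm-+ x y n) ⟩
    (x + y) * expTerm (x + y) n                   ≈⟨ expTerm-suc (x + y) n ⟨
    ν n * expTerm (x + y) (suc n)                 ∎)
    where
    a = expTerm x
    b = expTerm y
    left : conv (D a) b (suc n) ≈ x * conv a b n
    left = begin
      0# * a 0 * b (suc n) + conv (λ i → D a (suc i)) b n
        ≈⟨ +-cong (trans (*-congʳ (zeroˡ _)) (zeroˡ _)) (conv-congˡ b (D-expTerm x) n) ⟩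
      0# + conv (λ i → x * a i) b n
        ≈⟨ trans (+-identityˡ _) (conv-scaleˡ x a b n) ⟩
      x * conv a b n ∎
    right : conv a (D b) (suc n) ≈ y * conv a b n
    right = begin
      conv a (D b) (suc n)
        ≈⟨ conv-snoc a (D b) n ⟩
      conv a (λ j → D b (suc j)) n + a (suc n) * (0# * b 0)
        ≈⟨ +-cong (conv-congʳ a (D-expTerm y) n) (trans (*-congˡ (zeroˡ _)) (zeroʳ _)) ⟩
      conv a (λ i → y * b i) n + 0#
        ≈⟨ trans (+-identityʳ _) (conv-scaleʳ y a b n) ⟩
      y * conv a b n ∎

  -- The bound is f 0 + ... + f m, a sum instead of a maximum.
  eventually-antitone⇒bounded : ∀ m (f : ℕ → ℝ) → (∀ i → 0# ≤ f i) →
    (∀ i → f (suc (m ℕ.+ i)) ≤ f (m ℕ.+ i)) → ∃[ b ] 0# ≤ b × (∀ i → f i ≤ b)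
  eventually-antitone⇒bounded zero    f p d = f 0 , p 0 , antitone-≤ d 0
  eventually-antitone⇒bounded (suc m) f p d with eventually-antitone⇒bounded m (λ i → f (suc i)) (λ i → p (suc i)) d
  ... | b , 0≤b , f≤b = f 0 + b , +-nonneg (p 0) 0≤b , λ where
    zero    → ≤-resp (+-identityʳ _) refl (+-monoʳ-≤ (f 0) 0≤b)
    (suc i) → ≤-trans (f≤b i) (≤-resp (+-identityˡ _) refl (+-monoˡ-≤ b (p 0)))

  expTerm-nonneg : ∀ {x} → 0# ≤ x → ∀ n → 0# ≤ expTerm x n
  expTerm-nonneg 0≤x n = *-nonneg (<⇒≤ (pos (factorial⁺ n ⁻¹))) (^-nonneg 0≤x n)

  -- Consecutive terms have ratio x / (n + 1), which is at most 1 from any natural number above x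
  -- onwards.
  expTerm-bounded : ∀ {x} → 0# ≤ x → ∃[ b ] 0# ≤ b × (∀ i → expTerm x i ≤ b)
  expTerm-bounded {x} 0≤x with archimedean x
  ... | m , x<m = eventually-antitone⇒bounded m (expTerm x) (expTerm-nonneg 0≤x) λ i →
    *-cancelʳ-≤ (0<ν (m ℕ.+ i)) (≤-resp
      (trans (sym (expTerm-suc x (m ℕ.+ i))) (*-comm _ _)) (*-comm _ _)
      (*-monoˡ-≤ (expTerm-nonneg 0≤x (m ℕ.+ i)) (≤-trans (<⇒≤ x<m) (m≤ν i))))
    where
    m≤ν : ∀ i → m ℕ× 1# ≤ ν (m ℕ.+ i)
    m≤ν i = ≤-trans (≤-resp (+-identityʳ _) (sym (×-homo-+ 1# m i)) (+-monoʳ-≤ _ (ℕ×-nonneg i))) (ℕ×≤ν (m ℕ.+ i))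

  ¼ : ℝ
  ¼ = r 3

  4*¼ : (1# + 1# + (1# + 1#)) * ¼ ≈ 1#
  4*¼ = trans (*-congʳ (solve 0 (:1 :+ :1 :+ (:1 :+ :1) := :1 :+ (:1 :+ (:1 :+ con (+ 0))) :+ :1))) (ν*r 3)

  0≤¼ : 0# ≤ ¼
  0≤¼ = <⇒≤ (0<r 3)

  0≤¼^ : ∀ n → 0# ≤ ¼ ^ n
  0≤¼^ = ^-nonneg 0≤¼

  -- Domination by a geometric series bounds the error in cauchyProduct by a
  -- multiple of n 4⁻ⁿ.
  expTerm-geometric : ∀ x → ∃[ b ] 0# ≤ b × (∀ i → expTerm x i within b * ¼ ^ i)
  expTerm-geometric x = b , proj₁ (proj₂ bounded) , λ i → within-resp (scale i) refl
    (within-* {y = ¼ ^ i} (within-≤ (proj₂ (proj₂ bounded) i) (dominated i)) (nonneg⇒within (0≤¼^ i) (≤-reflexive refl)))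
    where
    -- The terms at 4x are 4ⁱ times those at x, so boundedness there is geometric decay here. As the
    -- sign of 4x is undecided, it is first replaced by a positive bound y of its absolute value.
    4x = (1# + 1# + (1# + 1#)) * x
    y : ℝ
    y = proj₁ (bound 4x)
    bounded : ∃[ b ] 0# ≤ b × (∀ i → expTerm y i ≤ b)
    bounded = expTerm-bounded (<⇒≤ (proj₁ (proj₂ (bound 4x))))
    b : ℝ
    b = proj₁ bounded
    dominated : ∀ i → expTerm 4x i within expTerm y i
    dominated i = within-* (nonneg⇒within (<⇒≤ (pos (factorial⁺ i ⁻¹))) (≤-reflexive refl))
                           (within-^ (proj₂ (proj₂ (bound 4x))) i)
    scale : ∀ i → expTerm 4x i * ¼ ^ i ≈ expTerm x i
    scale i = trans (*-assoc _ _ _) (*-congˡ (trans (sym (^-distrib-* 4x ¼ i)) (^-congˡ i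
      (trans (solve 3 (λ a x q → a :* x :* q := a :* q :* x) (1# + 1# + (1# + 1#)) x ¼)
        (trans (*-congʳ 4*¼) (*-identityˡ x))))))

  -- From n + 2 ≤ 2(n + 1), the square grows at most fourfold per step. Dividing by n + 1 bounds n
  -- 4⁻ⁿ by 1/(n + 1), which is how `ℕ×*¼^-Null` follows.
  square*¼^≤1 : ∀ n → ν n * ν n * ¼ ^ n ≤ 1#
  square*¼^≤1 zero    = ≤-reflexive (trans (*-identityʳ _) (trans (*-cong (+-identityˡ 1#) (+-identityˡ 1#)) (*-identityˡ 1#)))
  square*¼^≤1 (suc n) = ≤-trans (≤-resp refl eq
      (*-monoˡ-≤ (0≤¼^ (suc n)) (*-mono-≤ (+-nonneg 0≤ν 0≤ν) (<⇒≤ (0<ν (suc n))) double double)))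
    (square*¼^≤1 n)
    where
    0≤ν = <⇒≤ (0<ν n)
    double : ν (suc n) ≤ ν n + ν n
    double = ≤-resp (sym (ν-suc n)) refl (+-monoˡ-≤ (ν n) (1≤ν n))
    eq : (ν n + ν n) * (ν n + ν n) * (¼ * ¼ ^ n) ≈ ν n * ν n * ¼ ^ n
    eq = trans (solve 3 (λ a q p → (a :+ a) :* (a :+ a) :* (q :* p) := a :* a :* p :* ((:1 :+ :1 :+ (:1 :+ :1)) :* q)) (ν n) ¼ (¼ ^ n))
      (trans (*-congˡ 4*¼) (*-identityʳ _))

  ℕ×*¼^-Null : Null (λ n → n ℕ× 1# * ¼ ^ n)
  ℕ×*¼^-Null = Null-squeeze (λ n → nonneg⇒within (*-nonneg (ℕ×-nonneg n) (0≤¼^ n))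
      (≤-trans (*-monoˡ-≤ (0≤¼^ n) (ℕ×≤ν n))
        (*-cancelʳ-≤ (0<ν n) (≤-resp (solve 2 (λ a p → a :* a :* p := a :* p :* a) (ν n) (¼ ^ n))
          (trans (sym (ν*r n)) (*-comm _ _)) (square*¼^≤1 n)))))
    r-Null

  -- The right side is (3/2) b 4⁻ⁿ. The factor 2 in place of the sharp 4/3 avoids a division.
  geometric-step : ∀ b n → 0# ≤ b → b * ¼ ^ n ≤ (b + b) * ¼ ^ n - (b + b) * ¼ ^ suc n
  geometric-step b n 0≤b = 0≤-⇒≤ (≤-resp refl eq (+-nonneg 0≤t 0≤t))
    where
    t = b * ¼ ^ n * ¼
    0≤t : 0# ≤ t
    0≤t = *-nonneg (*-nonneg 0≤b (0≤¼^ n)) 0≤¼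
    eq : t + t ≈ (b + b) * ¼ ^ n - (b + b) * ¼ ^ suc n - b * ¼ ^ n
    eq = trans (solve 3 (λ b p q → b :* p :* q :+ b :* p :* q
          := b :* p :* ((:1 :+ :1 :+ (:1 :+ :1)) :* q) :+ :- ((b :+ b) :* (q :* p))) b (¼ ^ n) ¼)
        (trans (+-congʳ (trans (*-congˡ 4*¼) (*-identityʳ _)))
        (solve 3 (λ b p q → b :* p :+ :- ((b :+ b) :* (q :* p)) := (b :+ b) :* p :- (b :+ b) :* (q :* p) :- b :* p) b (¼ ^ n) ¼))

  geometric-tail : ∀ {g : ℕ → ℝ} {b} → 0# ≤ b → (∀ i → g i within b * ¼ ^ i) → ∀ {m n} → m ℕ.≤ n →
    partialSum g n - partialSum g m within (b + b) * ¼ ^ m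
  geometric-tail {b = b} 0≤b w {m} = telescope-tail (λ i → (b + b) * ¼ ^ i)
    (λ i → *-nonneg (+-nonneg 0≤b 0≤b) (0≤¼^ i)) (λ i → within-≤ (geometric-step b i 0≤b) (w i)) m

  -- The square of partial sums exceeds the triangle by `err`, where f i meets the block of g from n
  -- - i to n. That product is at most b 4⁻ⁱ * 2d 4⁻⁽ⁿ⁻ⁱ⁾ = 2bd 4⁻ⁿ, the same for each of the n
  -- values of i.
  cauchyProduct : ∀ {f g : ℕ → ℝ} {b d u v} → 0# ≤ b → 0# ≤ d →
    (∀ i → f i within b * ¼ ^ i) → (∀ i → g i within d * ¼ ^ i) →
    HasSum f u → HasSum g v → HasSum (conv f g) (u * v)
  cauchyProduct {f} {g} {b} {d} 0≤b 0≤d fw gw hf hg = ⟶-resp eq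
    (trans (+-congˡ -0#≈0#) (+-identityʳ _)) (⟶-+ (⟶-* hf hg) (⟶-neg (Null⇒⟶
      (Null-resp (λ n → sym (trans (+-congˡ -0#≈0#) (+-identityʳ (err n)))) err-Null))))
    where
    err : ℕ → ℝ
    err n = partialSum (λ i → f i * (partialSum g n - partialSum g (n ℕ.∸ i))) n
    eq : ∀ n → partialSum f n * partialSum g n - err n ≈ partialSum (conv f g) n
    eq n = begin
      partialSum f n * partialSum g n - err n
        ≈⟨ +-cong (Σ-*ʳ (partialSum g n) f n) (Σ-neg (λ i → f i * (partialSum g n - partialSum g (n ℕ.∸ i))) n) ⟩
      partialSum (λ i → f i * partialSum g n) n + partialSum (λ i → - (f i * (partialSum g n - partialSum g (n ℕ.∸ i)))) n
        ≈⟨ Σ-+ (λ i → f i * partialSum g n) (λ i → - (f i * (partialSum g n - partialSum g (n ℕ.∸ i)))) n ⟨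
      partialSum (λ i → f i * partialSum g n - f i * (partialSum g n - partialSum g (n ℕ.∸ i))) n
        ≈⟨ Σ-cong (λ i → solve 3 (λ f x y → f :* x :- f :* (x :- y) := f :* y) (f i) (partialSum g n) (partialSum g (n ℕ.∸ i))) n ⟩
      partialSum (λ i → f i * partialSum g (n ℕ.∸ i)) n
        ≈⟨ Σ-conv f g n ⟨
      partialSum (conv f g) n ∎
    B = b * (d + d)
    err-within : ∀ n → err n within n ℕ× 1# * ¼ ^ n * B
    err-within n = within-resp refl (trans (Σ-const (B * ¼ ^ n) n)
        (trans (*-congˡ (*-comm B (¼ ^ n))) (sym (*-assoc _ _ _))))
      (Σ-within n λ i i<n → within-resp refl (collect i (ℕₚ.<⇒≤ i<n))
        (within-* (fw i) (geometric-tail 0≤d gw (ℕₚ.m∸n≤m n i))))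
      where
      collect : ∀ i → i ℕ.≤ n → b * ¼ ^ i * ((d + d) * ¼ ^ (n ℕ.∸ i)) ≈ B * ¼ ^ n
      collect i i≤n = trans
        (solve 4 (λ b d p q → b :* p :* (d :* q) := b :* d :* (p :* q)) b (d + d) (¼ ^ i) (¼ ^ (n ℕ.∸ i)))
        (*-congˡ (trans (sym (^-homo-* ¼ i (n ℕ.∸ i))) (^-congʳ ¼ (ℕₚ.m+[n∸m]≡n i≤n))))
    err-Null : Null err
    err-Null = Null-squeeze err-within (Null-*ʳ B ℕ×*¼^-Null)

  IsRealExp : ℝ → ℝ → Set (c ⊔ ℓ₃)
  IsRealExp x u = HasSum (expTerm x) u

  exp-+ : ∀ {x y u v} → IsRealExp x u → IsRealExp y v → IsRealExp (x + y) (u * v)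
  exp-+ {x} {y} hx hy = HasSum-resp {conv (expTerm x) (expTerm y)} {expTerm (x + y)} (expTerm-+ x y) refl
    (cauchyProduct (proj₁ (proj₂ gx)) (proj₁ (proj₂ gy)) (proj₂ (proj₂ gx)) (proj₂ (proj₂ gy)) hx hy)
    where
    gx = expTerm-geometric x
    gy = expTerm-geometric y

  exp-resp : ∀ {x y u} → x ≈ y → IsRealExp x u → IsRealExp y u
  exp-resp {x} {y} eq = HasSum-resp {expTerm x} {expTerm y} (λ n → *-congˡ (^-congˡ n eq)) refl

  exp-0 : IsRealExp 0# 1#
  exp-0 = Null⇒⟶ λ ε 0<ε → 1 , close 0<ε
    where
    one : ∀ n → partialSum (expTerm 0#) (suc n) ≈ 1#
    one n = trans (+-cong (expTerm-0 0#) (trans (Σ-cong {λ i → expTerm 0# (suc i)} {λ _ → 0#} (λ i → trans (*-congˡ (zeroˡ _)) (zeroʳ _)) n)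
      (trans (Σ-const 0# n) (zeroʳ _)))) (+-identityʳ 1#)
    close : ∀ {ε} → 0# < ε → ∀ n → 1 ℕ.≤ n → partialSum (expTerm 0#) n - 1# within ε
    close 0<ε (suc n) _ = within-resp (sym (trans (+-congʳ (one n)) (-‿inverseʳ 1#))) refl
      (within-≤ (<⇒≤ 0<ε) within-0)

  exp-ℕ× : ∀ {x u} → IsRealExp x u → ∀ n → IsRealExp (n ℕ× 1# * x) (u ^ n)
  exp-ℕ× h zero    = exp-resp (sym (zeroˡ _)) exp-0
  exp-ℕ× {x} h (suc n) = exp-resp (trans (+-congʳ (sym (*-identityˡ x))) (sym (distribʳ x 1# (n ℕ× 1#))))
    (exp-+ h (exp-ℕ× h n))

  exp-inverse : ∀ {x y u v} → x + y ≈ 0# → IsRealExp x u → IsRealExp y v → u * v ≈ 1#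
  exp-inverse eq hx hy = ⟶-unique (exp-resp eq (exp-+ hx hy)) exp-0

  -- Values of the zeta function

  squares-within : ∀ {x y b} → 0# ≤ b → x * x + y * y ≤ b * b → x within b × y within b
  squares-within {x} {y} 0≤b p =
      square-within 0≤b (≤-trans (≤-resp (+-identityʳ _) refl (+-monoʳ-≤ (x * x) (square-nonneg y))) p)
    , square-within 0≤b (≤-trans (≤-resp (+-identityˡ _) refl (+-monoˡ-≤ (y * y) (square-nonneg x))) p)

  IsReal : ℂ → Set ℓ₁
  IsReal z = im z ≈ 0#

  re-* : ∀ {z w} → IsReal z → IsReal w → re (z C.* w) ≈ re z * re w
  re-* {z} {w} p q = trans (+-congˡ (-‿cong (trans (*-congʳ p) (zeroˡ _))))
    (trans (+-congˡ -0#≈0#) (+-identityʳ _))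

  IsReal-* : ∀ {z w} → IsReal z → IsReal w → IsReal (z C.* w)
  IsReal-* p q = trans (+-cong (trans (*-congˡ q) (zeroʳ _)) (trans (*-congʳ p) (zeroˡ _))) (+-identityˡ 0#)

  IsReal-^ : ∀ {z} → IsReal z → ∀ n → IsReal (z C.^ n)
  IsReal-^ p zero    = refl
  IsReal-^ p (suc n) = IsReal-* p (IsReal-^ p n)

  re-^ : ∀ {z} → IsReal z → ∀ n → re (z C.^ n) ≈ re z ^ n
  re-^ p zero    = refl
  re-^ {z} p (suc n) = trans (re-* {z} {z C.^ n} p (IsReal-^ p n)) (*-congˡ (re-^ p n))

  re-sum : ∀ (f : ℕ → ℂ) n → re (C.sum {n} (λ i → f (toℕ i))) ≈ partialSum (λ i → re (f i)) n
  re-sum f zero    = refl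
  re-sum f (suc n) = +-congˡ (re-sum (λ i → f (suc i)) n)

  IsReal-sum : ∀ (f : ℕ → ℂ) → (∀ i → IsReal (f i)) → ∀ n → IsReal (C.sum {n} (λ i → f (toℕ i)))
  IsReal-sum f p zero    = refl
  IsReal-sum f p (suc n) = trans (+-cong (p 0) (IsReal-sum (λ i → f (suc i)) (λ i → p (suc i)) n)) (+-identityˡ 0#)

  HasSumℂ⇒HasSum : ∀ {f : ℕ → ℂ} {w} → (∀ i → IsReal (f i)) → HasSumℂ f w →
    HasSum (λ i → re (f i)) (re w) × IsReal w
  HasSumℂ⇒HasSum {f} {w} real h = Null⇒⟶ (λ ε 0<ε → Eventually-map (λ n → proj₁) (close ε 0<ε))
    , trans (sym (-‿involutive _)) (trans (-‿cong (Null-const {x = - im w}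
        (λ ε 0<ε → Eventually-map (λ n → proj₂) (close ε 0<ε)))) -0#≈0#)
    where
    S : ℕ → ℂ
    S n = C.sum {n} (λ i → f (toℕ i))
    close : ∀ ε → 0# < ε → Eventually (λ n → partialSum (λ i → re (f i)) n - re w within ε × - im w within ε)
    close ε 0<ε = Eventually-map (λ n p → let q = squares-within (<⇒≤ 0<ε) (<⇒≤ p) in
        within-resp (+-congʳ (re-sum f n)) refl (proj₁ q)
      , within-resp (trans (+-congʳ (IsReal-sum f real n)) (+-identityˡ _)) refl (proj₂ q)) (h ε 0<ε)

  IsExp⇒IsRealExp : ∀ {z w} → IsReal z → IsExp z w → IsRealExp (re z) (re w) × IsReal w
  IsExp⇒IsRealExp {z} {w} p h = HasSum-resp {λ n → re (term n)} {expTerm (re z)}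
      (λ n → trans (re-* {ι _} {z C.^ n} refl (IsReal-^ p n)) (*-congˡ (re-^ p n))) refl (proj₁ sums)
    , proj₂ sums
    where
    term : ℕ → ℂ
    term n = ι (val (factorial⁺ n ⁻¹)) C.* z C.^ n
    sums : HasSum (λ n → re (term n)) (re w) × IsReal w
    sums = HasSumℂ⇒HasSum {term} (λ n → IsReal-* {ι _} {z C.^ n} refl (IsReal-^ p n)) h

  RealPower : ℝ → ℝ → ℝ → Set (c ⊔ ℓ₃)
  RealPower b x u = ∃[ l ] IsRealExp l b × IsRealExp (x * l) u

  IsPower⇒RealPower : ∀ {b z w} → IsReal z → IsPower b z w → RealPower (val b) (re z) (re w) × IsReal w
  IsPower⇒RealPower {b} {z} {w} p (l , log , exp) =
    (l , proj₁ (IsExp⇒IsRealExp {ι l} {ι (val b)} refl log) , exp-resp (re-* {z} {ι l} p refl) (proj₁ e)) , proj₂ e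
    where
    e : IsRealExp (re (z C.* ι l)) (re w) × IsReal w
    e = IsExp⇒IsRealExp {z C.* ι l} {w} (IsReal-* {z} {ι l} p refl) exp

  -- The values e^(ml) = b^m and e^(-ml) = u are inverse to each other. The resulting equation
  -- determines u with no reference to the logarithm l.
  RealPower-ℕ : ∀ {b u} m → RealPower b (- (m ℕ× 1#)) u → b ^ m * u ≈ 1#
  RealPower-ℕ m (l , log , exp) = exp-inverse
    (solve 2 (λ m l → m :* l :+ :- m :* l := con (+ 0)) (m ℕ× 1#) l) (exp-ℕ× log m) exp

  -- Since mx = 1, the exponents l and m(-xl) cancel, so b = e^l and u^m are inverse: u is an m-th
  -- root of 1/b.
  RealPower-fraction : ∀ {b x u} m → m ℕ× 1# * x ≈ 1# → RealPower b (- x) u → b * u ^ m ≈ 1#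
  RealPower-fraction {b} {x} m mx (l , log , exp) = exp-inverse
    (trans (solve 3 (λ m x l → l :+ m :* (:- x :* l) := l :+ :- (m :* x :* l)) (m ℕ× 1#) x l)
      (trans (+-congˡ (-‿cong (trans (*-congʳ mx) (*-identityˡ l)))) (-‿inverseʳ l)))
    log (exp-ℕ× exp m)

  -- A form of Bernoulli's inequality for 1/u, cleared of denominators. At u = 2^(-1/q), where u^q =
  -- 1/2, it reads q(1 - u) ≤ 1.
  bernoulli : ∀ {u} → 0# ≤ u → u ≤ 1# → ∀ q → u ^ q * (1# + q ℕ× 1# * (1# - u)) ≤ 1#
  bernoulli {u} 0≤u u≤1 zero    = ≤-reflexive (solve 1 (λ u → :1 :* (:1 :+ con (+ 0) :* (:1 :- u)) := :1) u)
  bernoulli {u} 0≤u u≤1 (suc q) = ≤-resp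
    (solve 3 (λ u p q → u :* (p :* (:1 :+ q :* (:1 :- u))) :+ u :* p :* (:1 :- u)
      := u :* p :* (:1 :+ (:1 :+ q) :* (:1 :- u))) u (u ^ q) (q ℕ× 1#))
    (solve 1 (λ u → u :* :1 :+ :1 :* (:1 :- u) := :1) u)
    (+-mono-≤ (*-monoʳ-≤ 0≤u (bernoulli 0≤u u≤1 q)) (*-monoˡ-≤ (≤⇒0≤- u≤1) (^-≤1 0≤u u≤1 (suc q))))

  -- The exponent is odd so that positivity of the root can be read off without
  -- knowing that exp is positive.
  odd-root-pos : ∀ {b u} j → 0# < b → b * u ^ suc (2 ℕ.* j) ≈ 1# → 0# < u
  odd-root-pos {b} {u} j 0<b eq = sign-of (#⇒<⊎> (invertible⇒# (inv
    , trans (solve 2 (λ i u → i :* (u :- con (+ 0)) := i :* u) inv u) inv*u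
    , trans (solve 2 (λ i u → (u :- con (+ 0)) :* i := i :* u) inv u) inv*u)))
    where
    inv = b * u ^ (2 ℕ.* j)
    inv*u : inv * u ≈ 1#
    inv*u = trans (solve 3 (λ b u p → b :* p :* u := b :* (u :* p)) b u (u ^ (2 ℕ.* j))) eq
    even-pos : u < 0# → 0# < u ^ (2 ℕ.* j)
    even-pos u<0 = <-resp refl (^-assocʳ u 2 j)
      (^-pos (<-resp refl (solve 1 (λ u → :- u :* :- u := u :* (u :* :1)) u) (*-pos (neg<0 u<0) (neg<0 u<0))) j)
    sign-of : u < 0# ⊎ 0# < u → 0# < u
    sign-of (inj₂ 0<u) = 0<u
    sign-of (inj₁ u<0) = ⊥-elim (<-irrefl (<-trans 0<1 (<-resp inv*u (zeroʳ _)
      (*-monoʳ-< (*-pos 0<b (even-pos u<0)) u<0))))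

  -- s + s - u 0 is the alternating sum of the differences u n - u (n + 1), which
  -- decrease by convexity.
  convex-alternating : ∀ {u : ℕ → ℝ} {s} → (∀ n → u (suc n) ≤ u n) →
    (∀ n → u (suc n) + u (suc n) ≤ u n + u (suc (suc n))) →
    HasSum (alternating u) s → s + s - u 0 within u 0 - u 1
  convex-alternating {u} dec conv h = ⟶-within bounds
    -- The lengths n + 1 and n make `parts` exact, with no boundary term left over.
    (⟶-resp parts refl (⟶-+ (⟶-+ (⟶-shift 1 h) h) ⟶-const))
    where
    d : ℕ → ℝ
    d n = u n - u (suc n)
    P : (ℕ → ℝ) → ℕ → ℝ
    P a = partialSum (alternating a)
    parts : ∀ n → P u (suc n) + P u n - u 0 ≈ P d n
    parts n = begin
      P u (suc n) + P u n - u 0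
        ≈⟨ +-congʳ (+-congʳ (unfold u n)) ⟩
      (u 0 - P u′ n) + P u n - u 0
        ≈⟨ solve 3 (λ a x y → (a :- x) :+ y :- a := y :+ :- x) (u 0) (P u′ n) (P u n) ⟩
      P u n + - P u′ n
        ≈⟨ +-congˡ (Σ-neg (alternating u′) n) ⟩
      P u n + partialSum (λ i → - alternating u′ i) n
        ≈⟨ Σ-+ (alternating u) (λ i → - alternating u′ i) n ⟨
      partialSum (λ i → alternating u i + - alternating u′ i) n
        ≈⟨ Σ-cong {λ i → alternating u i + - alternating u′ i} {alternating d}
            (λ i → solve 3 (λ s x y → s :* x :+ :- (s :* y) := s :* (x :- y)) (sign i) (u i) (u (suc i))) n ⟩
      P d n ∎
      where
      u′ : ℕ → ℝ
      u′ n = u (suc n)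
    bounds : ∀ n → P d n within d 0
    bounds n = let b = alternating-bounds d (λ n → ≤⇒0≤- (dec n)) d-dec n in nonneg⇒within (proj₁ b) (proj₂ b)
      where
      d-dec : ∀ n → d (suc n) ≤ d n
      d-dec n = 0≤-⇒≤ (≤-resp refl
        (solve 3 (λ x y z → (x :+ z) :- (y :+ y) := (x :- y) :- (y :- z)) (u n) (u (suc n)) (u (suc (suc n))))
        (≤⇒0≤- (conv n)))

  -- Here u n plays (n + 1)^(-1/q). Each comparison is made between q-th powers, where it concerns
  -- 1/(n + 1), and `^-cancel-≤` takes the root.
  module Roots (j : ℕ) {u : ℕ → ℝ} (root : ∀ n → ν n * u n ^ suc (2 ℕ.* j) ≈ 1#) where

    q : ℕ
    q = suc (2 ℕ.* j)

    0<u : ∀ n → 0# < u n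
    0<u n = odd-root-pos j (0<ν n) (root n)

    u^q : ∀ n → u n ^ q ≈ r n
    u^q n = ν-cancelˡ n (trans (root n) (sym (ν*r n)))

    u-decreasing : ∀ n → u (suc n) ≤ u n
    u-decreasing n = ^-cancel-≤ (0<u n) (2 ℕ.* j)
      (≤-resp (sym (u^q (suc n))) (sym (u^q n)) (r-decreasing n))

    -- Cross-multiplied, this is (n + 1)(n + 3) ≤ (n + 2)². Convexity is proved in logarithmic form
    -- first because q-th roots respect products but not sums.
    r-log-convex : ∀ n → r (suc n) * r (suc n) ≤ r n * r (suc (suc n))
    r-log-convex n = *-cancelʳ-≤ (*-pos (*-pos (0<ν n) (0<ν (suc (suc n)))) (*-pos (0<ν (suc n)) (0<ν (suc n))))
      (≤-resp
        (sym (trans (solve 4 (λ r a c b → r :* r :* (a :* c :* (b :* b)) := a :* c :* ((b :* r) :* (b :* r))) r₁ ν₀ ν₂ ν₁)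
          (trans (*-congˡ (trans (*-cong (ν*r (suc n)) (ν*r (suc n))) (*-identityˡ 1#))) (*-identityʳ _))))
        (sym (trans (solve 5 (λ r s a c b → r :* s :* (a :* c :* (b :* b)) := b :* b :* ((a :* r) :* (c :* s))) r₀ r₂ ν₀ ν₂ ν₁)
          (trans (*-congˡ (trans (*-cong (ν*r n) (ν*r (suc (suc n)))) (*-identityˡ 1#))) (*-identityʳ _))))
        (≤-resp (*-congˡ (trans (+-congˡ (sym (ν-suc n))) (sym (ν-suc (suc n))))) (*-cong (sym (ν-suc n)) (sym (ν-suc n)))
          (0≤-⇒≤ (≤-resp refl (solve 1 (λ x → :1 := (:1 :+ x) :* (:1 :+ x) :- x :* (:1 :+ (:1 :+ x))) ν₀) (<⇒≤ 0<1)))))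
      where
      r₀ = r n
      r₁ = r (suc n)
      r₂ = r (suc (suc n))
      ν₀ = ν n
      ν₁ = ν (suc n)
      ν₂ = ν (suc (suc n))

    u-log-convex : ∀ n → u (suc n) * u (suc n) ≤ u n * u (suc (suc n))
    u-log-convex n = ^-cancel-≤ (*-pos (0<u n) (0<u (suc (suc n)))) (2 ℕ.* j)
      (≤-resp (sym (power (suc n) (suc n))) (sym (power n (suc (suc n)))) (r-log-convex n))
      where
      power : ∀ m n → (u m * u n) ^ q ≈ r m * r n
      power m n = trans (^-distrib-* (u m) (u n) q) (*-cong (u^q m) (u^q n))

    -- With a, b, c three consecutive values, (a + c)² - (2b)² = (a - c)² + 4(ac - b²), and the last
    -- bracket is nonnegative by log-convexity.
    u-convex : ∀ n → u (suc n) + u (suc n) ≤ u n + u (suc (suc n))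
    u-convex n = ^-cancel-≤ (+-pos (0<u n) (0<u (suc (suc n)))) 1 (0≤-⇒≤ (≤-resp refl
      (solve 3 (λ a b c → (a :- c) :* (a :- c) :+ ((a :* c :- b :* b) :+ (a :* c :- b :* b) :+ ((a :* c :- b :* b) :+ (a :* c :- b :* b)))
        := (a :+ c) :* ((a :+ c) :* :1) :- (b :+ b) :* ((b :+ b) :* :1)) (u n) (u (suc n)) (u (suc (suc n))))
      (+-nonneg (square-nonneg _) (+-nonneg (+-nonneg gap gap) (+-nonneg gap gap)))))
      where gap = ≤⇒0≤- (u-log-convex n)

    u0≈1 : u 0 ≈ 1#
    u0≈1 = ≤-antisym (^-cancel-≤ 0<1 (2 ℕ.* j) (≤-reflexive power)) (^-cancel-≤ (0<u 0) (2 ℕ.* j) (≤-reflexive (sym power)))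
      where
      power : u 0 ^ q ≈ 1# ^ q
      power = trans (u^q 0) (trans (trans (sym (*-identityˡ _))
        (trans (*-congʳ (sym (+-identityˡ 1#))) (ν*r 0))) (sym (1^ q)))

    first-difference : u 0 - u 1 ≤ recipOdd j
    first-difference = ≤-resp (+-congʳ (sym u0≈1)) refl (*-cancelʳ-≤ (pos (odd j)) (≤-resp
      (trans (*-congʳ (sym (val-fromℕ⁺ q))) (*-comm _ _))
      (sym (trans (*-comm _ _) (*-inverseʳ (odd j)))) q[1-u]≤1))
      where
      u≤1 : u 1 ≤ 1#
      u≤1 = ≤-trans (u-decreasing 0) (≤-reflexive u0≈1)
      X = q ℕ× 1# * (1# - u 1)
      q[1-u]≤1 : X ≤ 1#
      q[1-u]≤1 = 0≤-⇒≤ (≤-resp refl (solve 1 (λ x → (:1 :+ :1) :- (:1 :+ x) := :1 :- x) X) (≤⇒0≤- (≤-resp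
        (trans (sym (*-assoc _ _ _)) (trans (*-congʳ (root 1)) (*-identityˡ _)))
        (trans (*-identityʳ _) (trans (ν-suc 0) (+-congˡ (+-identityˡ 1#))))
        (*-monoʳ-≤ (<⇒≤ (0<ν 1)) (bernoulli (<⇒≤ (0<u 1)) u≤1 q)))))

    alternating-near-half : ∀ {s} → HasSum (alternating u) s → s + s - 1# within recipOdd j
    alternating-near-half h = within-resp (+-congˡ (-‿cong u0≈1)) refl
      (within-≤ first-difference (convex-alternating u-decreasing u-convex h))

  recipOdd-Null : Null recipOdd
  recipOdd-Null = antitone-Null (λ n → <⇒≤ (L.positive n)) (λ n → <⇒≤ (L.decreasing n)) L.null
    where module L = IsLeibniz recipOdd-leibniz

  module Zeta {ζ : ℂ → ℂ} (isζ : IsAlternatingHurwitzZeta 1⁺ ζ) where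
    open IsAlternatingHurwitzZeta isζ using (entire; series)

    ζ-series : ∀ z → 0# < re z → IsReal z → IsReal (ζ z) ×
      ∃[ u ] HasSum (alternating u) (re (ζ z)) × (∀ n → RealPower (ν n) (- re z) (u n))
    ζ-series z 0<z real = proj₂ sums
      , (λ n → re (t n))
      , HasSum-resp {λ n → re (term n)} {alternating (λ n → re (t n))} (λ n → re-* {ι (sign n)} {t n} refl (proj₂ (powers n))) refl (proj₁ sums)
      , (λ n → proj₁ (powers n))
      where
      t : ℕ → ℂ
      t = proj₁ (series z 0<z)
      term : ℕ → ℂ
      term n = ι (sign n) C.* t n
      powers : ∀ n → RealPower (ν n) (- re z) (re (t n)) × IsReal (t n)
      powers n = IsPower⇒RealPower {shift n 1⁺} {C.- z} {t n} (trans (-‿cong real) -0#≈0#) (proj₁ (proj₂ (series z 0<z)) n)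
      sums : HasSum (λ n → re (term n)) (re (ζ z)) × IsReal (ζ z)
      sums = HasSumℂ⇒HasSum {term} (λ n → IsReal-* {ι (sign n)} {t n} refl (proj₂ (powers n))) (proj₂ (proj₂ (series z 0<z)))

    ζ-ℕ : ∀ m .{{_ : NonZero m}} → HasSum (alternating (λ n → r n ^ m)) (re (ζ (fromℕ m))) × IsReal (ζ (fromℕ m))
    ζ-ℕ m@(suc m-1) = HasSum-resp {alternating u} {alternating (λ n → r n ^ m)} (λ n → *-congˡ (u≈ n)) refl (proj₁ (proj₂ (proj₂ s))) , proj₁ s
      where
      s = ζ-series (fromℕ m) (<-≤-trans 0<1 (≤-resp (+-identityʳ 1#) refl (+-monoʳ-≤ 1# (ℕ×-nonneg m-1)))) refl
      u : ℕ → ℝ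
      u = proj₁ (proj₂ s)
      u≈ : ∀ n → u n ≈ r n ^ m
      u≈ n = begin
        u n                          ≈⟨ *-identityˡ _ ⟨
        1# * u n                     ≈⟨ *-congʳ (trans (^-congˡ m (trans (*-comm _ _) (ν*r n))) (1^ m)) ⟨
        (r n * ν n) ^ m * u n        ≈⟨ *-congʳ (^-distrib-* (r n) (ν n) m) ⟩
        r n ^ m * ν n ^ m * u n      ≈⟨ *-assoc _ _ _ ⟩
        r n ^ m * (ν n ^ m * u n)    ≈⟨ *-congˡ (RealPower-ℕ m (proj₂ (proj₂ (proj₂ s)) n)) ⟩
        r n ^ m * 1#                 ≈⟨ *-identityʳ _ ⟩
        r n ^ m                      ∎

    ζ-fraction : ∀ j z → re z ≈ recipOdd j → IsReal z →
      re (ζ z) + re (ζ z) - 1# within recipOdd j × IsReal (ζ z)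
    ζ-fraction j z eq real = Roots.alternating-near-half j
        (λ n → RealPower-fraction (suc (2 ℕ.* j)) q*z (proj₂ (proj₂ (proj₂ s)) n)) (proj₁ (proj₂ (proj₂ s)))
      , proj₁ s
      where
      s = ζ-series z (<-resp refl (sym eq) (pos (odd j ⁻¹))) real
      q*z : suc (2 ℕ.* j) ℕ× 1# * re z ≈ 1#
      q*z = trans (*-cong (sym (val-fromℕ⁺ (suc (2 ℕ.* j)))) eq) (*-inverseʳ (odd j))

    ζ-0 : re (ζ (fromℕ 0)) + re (ζ (fromℕ 0)) ≈ 1# × IsReal (ζ (fromℕ 0))
    ζ-0 = trans (sym (x-y+y _ 1#)) (trans (+-congʳ (Null-const re-Null)) (+-identityˡ 1#))
      , Null-const im-Null
      where
      z₀ = fromℕ 0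
      derivative = entire z₀
      d : ℂ
      d = proj₁ derivative
      h : ℕ → ℝ
      h = recipOdd
      w : ℕ → ℂ
      w j = z₀ C.+ ι (h j)
      near-half : ∀ j → re (ζ (w j)) + re (ζ (w j)) - 1# within h j × IsReal (ζ (w j))
      near-half j = ζ-fraction j (w j) (+-identityˡ _) (+-identityˡ 0#)
      error : ℕ → ℂ
      error j = ζ (w j) C.- ζ z₀ C.- d C.* ι (h j)
      -- Only continuity at 0 is wanted, so ε = 1 will do: the error is then at most h = 1/q, which
      -- tends to 0 anyway.
      δ-data = proj₂ derivative 1# 0<1
      δ = proj₁ δ-data
      0<δ = proj₁ (proj₂ δ-data)
      error-small : Eventually (λ j → re (error j) within h j × im (error j) within h j)
      error-small = Eventually-map (λ j p → squares-within (0≤h j) (≤-resp refl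
          (solve 1 (λ h → :1 :* :1 :* (h :* h :+ con (+ 0) :* con (+ 0)) := h :* h) (h j))
          (proj₂ (proj₂ δ-data) (ι (h j)) (inside j (proj₁ p)))))
        (recipOdd-Null η 0<η)
        where
        η-data = halve 0<δ
        η = proj₁ η-data
        0<η = proj₁ (proj₂ η-data)
        η<δ : η < δ
        η<δ = half< 0<η (proj₂ (proj₂ η-data))
        0≤h : ∀ j → 0# ≤ h j
        0≤h j = <⇒≤ (pos (odd j ⁻¹))
        inside : ∀ j → h j ≤ η → ∣ ι (h j) ∣² < δ * δ
        inside j h≤η = ≤-<-trans
          (≤-resp (solve 1 (λ h → h :* h := h :* h :+ con (+ 0) :* con (+ 0)) (h j)) refl
            (*-mono-≤ (<⇒≤ 0<η) (0≤h j) h≤η h≤η))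
          (<-trans (*-monoˡ-< 0<η η<δ) (*-monoʳ-< 0<δ η<δ))
      Null-error : ∀ {e : ℕ → ℝ} → Eventually (λ j → e j within h j) → Null e
      Null-error ev ε 0<ε = Eventually-map (λ j (p , q) → within-≤ (proj₁ q) p)
        (Eventually-× {λ j → _} {λ j → _} ev (recipOdd-Null ε 0<ε))
      -- 2ζ(0) - 1 is rewritten as (2ζ(h) - 1) - 2 error - 2hd in real parts, and each of the three
      -- is null. For the imaginary part, ζ(h) itself is real.
      re-Null : Null (λ j → re (ζ z₀) + re (ζ z₀) - 1#)
      re-Null = Null-resp
        (λ j → solve 5 (λ a b x y h → ((a :+ a :- :1) :+ :- ((a :- b) :- (x :* h :- y :* con (+ 0))) :+ :- ((a :- b) :- (x :* h :- y :* con (+ 0)))) :+ h :* :- (x :+ x)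
          := b :+ b :- :1) (re (ζ (w j))) (re (ζ z₀)) (re d) (im d) (h j))
        (Null-+ (Null-+ (Null-+ (Null-squeeze (λ j → proj₁ (near-half j)) recipOdd-Null) e) e)
          (Null-*ʳ (- (re d + re d)) recipOdd-Null))
        where
        e : Null (λ j → - re (error j))
        e = Null-neg (Null-error (Eventually-map (λ j → proj₁) error-small))
      im-Null : Null (λ j → im (ζ z₀))
      im-Null = Null-resp
        (λ j → trans (+-congʳ (-‿cong (+-congʳ (+-congʳ (proj₂ (near-half j))))))
          (solve 4 (λ b x y h → :- ((con (+ 0) :- b) :- (x :* con (+ 0) :+ y :* h)) :+ h :* :- y := b) (im (ζ z₀)) (re d) (im d) (h j)))
        (Null-+ (Null-neg (Null-error (Eventually-map (λ j → proj₂) error-small))) (Null-*ʳ (- im d) recipOdd-Null))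

  -- The kernel series

  *-cancelʳ : ∀ {x y z} → 0# < z → x * z ≈ y * z → x ≈ y
  *-cancelʳ 0<z eq = ≤-antisym (*-cancelʳ-≤ 0<z (≤-reflexive eq)) (*-cancelʳ-≤ 0<z (≤-reflexive (sym eq)))

  inverse-^ : ∀ {x y} → x * y ≈ 1# → ∀ n → x ^ n * y ^ n ≈ 1#
  inverse-^ {x} {y} eq n = trans (sym (^-distrib-* x y n)) (trans (^-congˡ n eq) (1^ n))

  -- Exponents m - 1 are handled by multiplying the missing factor back in, which treats m = 0
  -- (exponent -1) alike. That case occurs at p = 0 and p = N + 1.
  ^ℤ-pred : ∀ x m → val (x ^ℤ (m ⊖ 1)) * val x ≈ val x ^ m
  ^ℤ-pred x zero    = trans (*-congʳ (*-identityʳ _)) (trans (*-comm _ _) (*-inverseʳ x))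
  ^ℤ-pred x (suc m) = *-comm _ _

  ^ℤ-pred-inverse : ∀ x m → val ((x ^ℤ (m ⊖ 1)) ⁻¹) ≈ val x * val (x ⁻¹) ^ m
  ^ℤ-pred-inverse x m = *-cancelʳ (pos y) (begin
    val (y ⁻¹) * val y                  ≈⟨ trans (*-comm _ _) (*-inverseʳ y) ⟩
    1#                                  ≈⟨ inverse-^ (*-inverseʳ x) m ⟨
    val x ^ m * val (x ⁻¹) ^ m          ≈⟨ *-congʳ (^ℤ-pred x m) ⟨
    val y * val x * val (x ⁻¹) ^ m      ≈⟨ solve 3 (λ y x p → y :* x :* p := x :* p :* y) (val y) (val x) (val (x ⁻¹) ^ m) ⟩
    val x * val (x ⁻¹) ^ m * val y      ∎)
    where
    y = x ^ℤ (m ⊖ 1)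

  ^-antitone : ∀ {x} → 0# ≤ x → x ≤ 1# → ∀ m n → x ^ (m ℕ.+ n) ≤ x ^ m
  ^-antitone {x} 0≤x x≤1 m n = ≤-resp (sym (^-homo-* x m n)) (*-identityʳ _)
    (*-monoʳ-≤ (^-nonneg 0≤x m) (^-≤1 0≤x x≤1 n))

  r^≤r² : ∀ n m → 2 ℕ.≤ m → r n ^ m ≤ r n * r n
  r^≤r² n m 2≤m = ≤-resp (^-congʳ (r n) (ℕₚ.m+[n∸m]≡n 2≤m)) (*-congˡ (*-identityʳ _))
    (^-antitone (<⇒≤ (0<r n)) (r≤1 n) 2 (m ℕ.∸ 2))

  -- Cleared of denominators this is n + 2 ≤ 2(n + 1). It supplies the majorant 2/(n + 1) for the
  -- tails of the main series.
  r²-telescope : ∀ n → r n * r n ≤ (r n + r n) - (r (suc n) + r (suc n))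
  r²-telescope n = *-cancelʳ-≤ (*-pos (0<ν n) (*-pos (0<ν n) (0<ν (suc n)))) (≤-resp
    (sym (trans (solve 3 (λ r a b → r :* r :* (a :* (a :* b)) := (a :* r) :* (a :* r) :* b) (r n) (ν n) (ν (suc n)))
      (trans (*-congʳ (trans (*-cong (ν*r n) (ν*r n)) (*-identityˡ 1#))) (*-identityˡ _))))
    (sym (trans (solve 4 (λ r s a b → ((r :+ r) :- (s :+ s)) :* (a :* (a :* b)) := (a :* r) :* (a :* b) :+ (a :* r) :* (a :* b) :- ((b :* s) :* (a :* a) :+ (b :* s) :* (a :* a))) (r n) (r (suc n)) (ν n) (ν (suc n)))
      (trans (+-cong (+-cong rab rab) (-‿cong (+-cong saa saa)))
        (trans (+-cong (+-cong abb abb) refl)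
          (solve 1 (λ a → (a :* (:1 :+ a) :+ a :* (:1 :+ a)) :- (a :* a :+ a :* a) := a :+ a) (ν n))))))
    (≤-resp (sym (ν-suc n)) refl (+-monoˡ-≤ (ν n) (1≤ν n))))
    where
    abb : ν n * ν (suc n) ≈ ν n * (1# + ν n)
    abb = *-congˡ (ν-suc n)
    rab : (ν n * r n) * (ν n * ν (suc n)) ≈ ν n * ν (suc n)
    rab = trans (*-congʳ (ν*r n)) (*-identityˡ _)
    saa : (ν (suc n) * r (suc n)) * (ν n * ν n) ≈ ν n * ν n
    saa = trans (*-congʳ (ν*r (suc n))) (*-identityˡ _)

  ½ : ℝ
  ½ = r 1

  0≤½ : 0# ≤ ½
  0≤½ = <⇒≤ (0<r 1)

  ½-unique : ∀ {x} → x + x ≈ 1# → x ≈ ½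
  ½-unique {x} eq = ν-cancelˡ 1 (trans (*-congʳ (trans (ν-suc 0) (+-congˡ (+-identityˡ 1#))))
    (trans (solve 1 (λ x → (:1 :+ :1) :* x := x :+ x) x) (trans eq (sym (ν*r 1)))))

  module FixedOrder (k : ℕ) .{{_ : NonZero k}} where

    2≤2k : 2 ℕ.≤ 2 ℕ.* k
    2≤2k = ℕₚ.m≤m*n 2 k

    A B : ℕ → ℝ
    A n = ν n ^ (2 ℕ.* k)
    B n = r n ^ (2 ℕ.* k)

    A*B : ∀ n → A n * B n ≈ 1#
    A*B n = inverse-^ (ν*r n) (2 ℕ.* k)

    0<A : ∀ n → 0# < A n
    0<A n = ^-pos (0<ν n) (2 ℕ.* k)

    0<B : ∀ n → 0# < B n
    0<B n = ^-pos (0<r n) (2 ℕ.* k)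

    0≤B^ : ∀ n p → 0# ≤ B n ^ p
    0≤B^ n p = ^-nonneg (<⇒≤ (0<B n)) p

    B≤1 : ∀ n → B n ≤ 1#
    B≤1 n = ^-≤1 (<⇒≤ (0<r n)) (r≤1 n) (2 ℕ.* k)

    B≤r² : ∀ n → B n ≤ r n * r n
    B≤r² n = r^≤r² n (2 ℕ.* k) 2≤2k

    A*B^ : ∀ n p → A n * B n ^ suc p ≈ B n ^ p
    A*B^ n p = trans (sym (*-assoc _ _ _)) (trans (*-congʳ (A*B n)) (*-identityˡ _))

    module Kernel (γ : ℝ⁺) where

      -- The ρ of the overview when γ = α, and its inverse when γ = β.
      X : ℝ
      X = (val γ * val (π ⁻¹)) ^ (2 ℕ.* k)

      0<X : 0# < X
      0<X = ^-pos (*-pos (pos γ) (pos (π ⁻¹))) (2 ℕ.* k)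

      x : ℕ → ℝ⁺
      x i = γ *⁺ shift i 1⁺ *⁺ π ⁻¹

      x^2k : ∀ i → val (x i) ^ (2 ℕ.* k) ≈ X * A i
      x^2k i = trans (^-congˡ (2 ℕ.* k) (solve 3 (λ g n p → g :* n :* p := g :* p :* n) (val γ) (ν i) (val (π ⁻¹))))
        (^-distrib-* (val γ * val (π ⁻¹)) (ν i) (2 ℕ.* k))

      κ : ℕ → ℕ → ℝ
      κ i = kernelTerm (x i) 1⁺ k

      κ-inverse : ∀ i m → (A m + X * A i) * κ i m ≈ 1#
      κ-inverse i m = trans (*-congʳ (+-congˡ (sym (x^2k i)))) (*-inverseʳ (shift m 1⁺ ^⁺ (2 ℕ.* k) +⁺ x i ^⁺ (2 ℕ.* k)))

      0≤κ : ∀ i m → 0# ≤ κ i m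
      0≤κ i m = <⇒≤ (IsLeibniz.positive (kernelTerm-leibniz (x i) 1⁺ k) m)

      κ-decreasing : ∀ i m → κ i (suc m) ≤ κ i m
      κ-decreasing i m = <⇒≤ (IsLeibniz.decreasing (kernelTerm-leibniz (x i) 1⁺ k) m)

      0≤XA : ∀ i → 0# ≤ X * A i
      0≤XA i = <⇒≤ (*-pos 0<X (0<A i))

      -- Dropping `A m` from the denominator keeps X A i κ bounded; `κ≤B` drops the other summand
      -- and gives decay in m uniformly in i.
      XAκ≤1 : ∀ i m → X * A i * κ i m ≤ 1#
      XAκ≤1 i m = ≤-resp refl (κ-inverse i m) (*-monoˡ-≤ (0≤κ i m)
        (≤-resp (+-identityˡ _) refl (+-monoˡ-≤ (X * A i) (<⇒≤ (0<A m)))))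

      κ≤B : ∀ i m → κ i m ≤ B m
      κ≤B i m = *-cancelʳ-≤ (0<A m) (≤-resp (*-comm _ _) (trans (κ-inverse i m) (sym (trans (*-comm _ _) (A*B m))))
        (*-monoˡ-≤ (0≤κ i m) (≤-resp (+-identityʳ _) refl (+-monoʳ-≤ (A m) (0≤XA i)))))

      G : ℕ → ℝ
      G i = alternatingSum (kernelTerm-leibniz (x i) 1⁺ k)

      P : ℕ → ℕ → ℝ
      P i = partialSum (alternating (κ i))

      remainder : ∀ i M → G i - P i M within κ i M
      remainder i = alternating-remainder (0≤κ i) (κ-decreasing i) (proj₂ (leibniz (kernelTerm-leibniz (x i) 1⁺ k)))

      -- As γn/π = x, the factor γn turns -1/(2πx) into -1/2 and x^(2k-1)/π into x^(2k) = X n^(2k),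
      -- so π survives only inside X.
      F-normalised : ∀ i → val γ * ν i * F[ γ ] (shift i 1⁺) 1⁺ k ≈ - ½ + X * A i * G i
      F-normalised i = begin
        g * n * (- y + z * p * G i)
          ≈⟨ solve 6 (λ g n y z p a → g :* n :* (:- y :+ z :* p :* a) := :- (g :* n :* y) :+ z :* (g :* n :* p) :* a) g n y z p (G i) ⟩
        - (g * n * y) + z * val (x i) * G i
          ≈⟨ +-cong (-‿cong half) (*-congʳ (trans (^ℤ-pred (x i) (2 ℕ.* k)) (x^2k i))) ⟩
        - ½ + X * A i * G i ∎
        where
        g = val γ
        n = ν i
        p = val (π ⁻¹)
        y = val ((fromℕ⁺ 2 *⁺ π *⁺ x i) ⁻¹)
        z = val (x i ^ℤ (2 ℕ.* k ⊖ 1))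
        half : g * n * y ≈ ½
        half = ν-cancelˡ 1 (begin
          ν 1 * (g * n * y)                    ≈⟨ *-identityʳ _ ⟨
          ν 1 * (g * n * y) * 1#               ≈⟨ *-congˡ (*-inverseʳ π) ⟨
          ν 1 * (g * n * y) * (val π * p)      ≈⟨ solve 6 (λ t g n y q p → t :* (g :* n :* y) :* (q :* p) := t :* q :* (g :* n :* p) :* y) (ν 1) g n y (val π) p ⟩
          ν 1 * val π * (g * n * p) * y        ≈⟨ *-inverseʳ (fromℕ⁺ 2 *⁺ π *⁺ x i) ⟩
          1#                                   ≈⟨ ν*r 1 ⟨
          ν 1 * ½                              ∎)

      term : ℕ → ℕ → ℝ
      term K i = sign i * F[ γ ] (fromℕ⁺ (suc i)) 1⁺ k * val ((fromℕ⁺ (suc i) ^ℤ (2 ℕ.* k ℕ.* K ⊖ 1)) ⁻¹)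

      module _ (N : ℕ) where

        K : ℕ
        K = suc N

        scaled : ℕ → ℝ
        scaled i = sign i * (- ½ + X * A i * G i) * B i ^ K

        scaled≈ : ∀ i → val γ * term K i ≈ scaled i
        scaled≈ i = begin
          val γ * (sign i * f * val ((fromℕ⁺ (suc i) ^ℤ (2 ℕ.* k ℕ.* K ⊖ 1)) ⁻¹))
            ≈⟨ *-congˡ (*-congˡ (^ℤ-pred-inverse (shift i 1⁺) (2 ℕ.* k ℕ.* K))) ⟩
          val γ * (sign i * f * (ν i * r i ^ (2 ℕ.* k ℕ.* K)))
            ≈⟨ solve 5 (λ g s f n p → g :* (s :* f :* (n :* p)) := s :* (g :* n :* f) :* p) (val γ) (sign i) f (ν i) (r i ^ (2 ℕ.* k ℕ.* K)) ⟩
          sign i * (val γ * ν i * f) * r i ^ (2 ℕ.* k ℕ.* K)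
            ≈⟨ *-cong (*-congˡ (F-normalised i)) (sym (^-assocʳ (r i) (2 ℕ.* k) K)) ⟩
          scaled i ∎
          where
          f = F[ γ ] (shift i 1⁺) 1⁺ k

        b : ℝ
        b = 1# * (½ + 1#)

        0≤b : 0# ≤ b
        0≤b = *-nonneg (<⇒≤ 0<1) (+-nonneg 0≤½ (<⇒≤ 0<1))

        -- In `b`, the summand 1/2 comes from the residue and 1 from `XAκ≤1`. Since `P i 0` is
        -- empty, `remainder i 0` bounds `G i` itself.
        scaled-within : ∀ i → scaled i within b * (r i * r i)
        scaled-within i = within-* (within-* (sign-within i)
          (within-+ (within-neg (nonneg⇒within 0≤½ (≤-reflexive refl)))
            (within-≤ (XAκ≤1 i 0) (within-* (nonneg⇒within (0≤XA i) (≤-reflexive refl))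
              (within-resp (trans (+-congˡ -0#≈0#) (+-identityʳ _)) refl (remainder i 0))))))
          (nonneg⇒within (0≤B^ i K) (≤-trans
            (≤-resp refl (*-identityʳ _) (^-antitone (<⇒≤ (0<B i)) (B≤1 i) 1 N)) (B≤r² i)))

        scaled-sum : ∃[ s ] HasSum scaled s
        scaled-sum = telescope-summable (λ i → (r i + r i) * b)
          (λ i → *-nonneg (+-nonneg (<⇒≤ (0<r i)) (<⇒≤ (0<r i))) 0≤b)
          (Null-*ʳ b (Null-+ r-Null r-Null))
          (λ i → within-≤ (≤-resp (*-comm _ _)
            (solve 3 (λ x y b → (x :- y) :* b := x :* b :- y :* b) (r i + r i) (r (suc i) + r (suc i)) b)
            (*-monoˡ-≤ 0≤b (r²-telescope i))) (scaled-within i))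

        S : ℝ
        S = val (γ ⁻¹) * proj₁ scaled-sum

        term-sum : HasSum (term K) S
        term-sum = ⟶-resp (λ n → trans (Σ-*ˡ (val (γ ⁻¹)) scaled n) (Σ-cong {λ i → val (γ ⁻¹) * scaled i} {term K} unscale n)) refl
          (⟶-*ˡ (val (γ ⁻¹)) (proj₂ scaled-sum))
          where
          unscale : ∀ i → val (γ ⁻¹) * scaled i ≈ term K i
          unscale i = trans (*-congˡ (sym (scaled≈ i))) (trans (sym (*-assoc _ _ _))
            (trans (*-congʳ (trans (*-comm _ _) (*-inverseʳ γ))) (*-identityˡ _)))

        truncated : ℕ → ℝ
        truncated M = partialSum (λ i → sign i * (- ½ + X * A i * P i M) * B i ^ K) M

        truncated-limit : truncated ⟶ (val γ * S)
        truncated-limit = ⟶-resp eq limit (⟶-+ (proj₂ scaled-sum) (⟶-neg (Null⇒⟶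
            (Null-resp (λ M → sym (trans (+-congˡ -0#≈0#) (+-identityʳ (err M)))) err-Null))))
          where
          limit : proj₁ scaled-sum - 0# ≈ val γ * S
          limit = trans (trans (+-congˡ -0#≈0#) (+-identityʳ _)) (sym (trans (sym (*-assoc _ _ _))
            (trans (*-congʳ (*-inverseʳ γ)) (*-identityˡ _))))
          δ : ℕ → ℕ → ℝ
          δ M i = sign i * (X * A i * (G i - P i M)) * B i ^ K
          err : ℕ → ℝ
          err M = partialSum (δ M) M
          eq : ∀ M → partialSum scaled M - err M ≈ truncated M
          eq M = begin
            partialSum scaled M - err M
              ≈⟨ +-congˡ (Σ-neg (δ M) M) ⟩
            partialSum scaled M + partialSum (λ i → - δ M i) M
              ≈⟨ Σ-+ scaled (λ i → - δ M i) M ⟨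
            partialSum (λ i → scaled i + - δ M i) M
              ≈⟨ Σ-cong {λ i → scaled i + - δ M i} (λ i → solve 6 (λ s h x g p q →
                   s :* (:- h :+ x :* g) :* q :+ :- (s :* (x :* (g :- p)) :* q) := s :* (:- h :+ x :* p) :* q)
                   (sign i) ½ (X * A i) (G i) (P i M) (B i ^ K)) M ⟩
            truncated M ∎
          -- One factor of (B i)^(N+1) absorbs `A i`, so the bound is independent of i; M such terms
          -- sum to at most X/(M + 1).
          δ-within : ∀ M i → δ M i within X * (r M * r M)
          δ-within M i = within-≤ (≤-resp refl (*-congˡ (*-identityʳ _)) small)
            (within-* (within-* (sign-within i) (within-* (nonneg⇒within (0≤XA i) (≤-reflexive refl)) (remainder i M)))
              (nonneg⇒within (0≤B^ i K) (≤-reflexive refl)))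
            where
            small : 1# * (X * A i * κ i M) * B i ^ K ≤ X * (r M * r M * 1#)
            small = ≤-resp
              (trans (*-congˡ (*-congˡ (sym (A*B^ i N))))
                (solve 4 (λ x a t q → x :* (t :* (a :* q)) := :1 :* (x :* a :* t) :* q) X (A i) (κ i M) (B i ^ K)))
              refl
              (*-monoʳ-≤ (<⇒≤ 0<X) (*-mono-≤ (*-nonneg (<⇒≤ (0<r M)) (<⇒≤ (0<r M))) (0≤B^ i N)
                (≤-trans (κ≤B i M) (B≤r² M)) (^-≤1 (<⇒≤ (0<B i)) (B≤1 i) N)))
          err-within : ∀ M → err M within r M * X
          err-within M = within-≤ (≤-resp (sym (Σ-const (X * (r M * r M)) M)) cancel
              (*-monoˡ-≤ (*-nonneg (<⇒≤ 0<X) (*-nonneg (<⇒≤ (0<r M)) (<⇒≤ (0<r M)))) (ℕ×≤ν M)))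
            (Σ-within M (λ i _ → δ-within M i))
            where
            cancel : ν M * (X * (r M * r M)) ≈ r M * X
            cancel = trans (solve 3 (λ n x r → n :* (x :* (r :* r)) := (n :* r) :* (r :* x)) (ν M) X (r M))
              (trans (*-congʳ (ν*r M)) (*-identityˡ _))
          err-Null : Null err
          err-Null = Null-squeeze err-within (Null-*ʳ X r-Null)

  -- The reciprocity relation

  signed : (ℕ → ℕ → ℝ) → ℕ → ℕ → ℝ
  signed f i m = sign i * (sign m * f i m)

  Σ₂ : (ℕ → ℕ → ℝ) → ℕ → ℝ
  Σ₂ f M = partialSum (λ i → partialSum (signed f i) M) M

  Σ₂-cong : ∀ {f g : ℕ → ℕ → ℝ} → (∀ i m → f i m ≈ g i m) → ∀ M → Σ₂ f M ≈ Σ₂ g M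
  Σ₂-cong {f} {g} eq M = Σ-cong (λ i → Σ-cong {signed f i} {signed g i} (λ m → *-congˡ (*-congˡ (eq i m))) M) M

  Σ₂-comm : ∀ (f : ℕ → ℕ → ℝ) M → Σ₂ f M ≈ Σ₂ (λ i m → f m i) M
  Σ₂-comm f M = trans (Σ-comm (signed f) M M)
    (Σ-cong (λ m → Σ-cong {λ i → signed f i m} {signed (λ i m → f m i) m}
      (λ i → solve 3 (λ s t f → s :* (t :* f) := t :* (s :* f)) (sign i) (sign m) (f i m)) M) M)

  Σ₂-+ : ∀ (f g : ℕ → ℕ → ℝ) M → Σ₂ f M + Σ₂ g M ≈ Σ₂ (λ i m → f i m + g i m) M
  Σ₂-+ f g M = trans (sym (Σ-+ (λ i → partialSum (signed f i) M) (λ i → partialSum (signed g i) M) M))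
    (Σ-cong (λ i → trans (sym (Σ-+ (signed f i) (signed g i) M))
      (Σ-cong {λ m → signed f i m + signed g i m} {signed (λ i m → f i m + g i m) i}
        (λ m → solve 4 (λ s t f g → s :* (t :* f) :+ s :* (t :* g) := s :* (t :* (f :+ g))) (sign i) (sign m) (f i m) (g i m)) M)) M)

  Σ₂-*ˡ : ∀ x (f : ℕ → ℕ → ℝ) M → x * Σ₂ f M ≈ Σ₂ (λ i m → x * f i m) M
  Σ₂-*ˡ x f M = trans (Σ-*ˡ x (λ i → partialSum (signed f i) M) M) (Σ-cong (λ i → trans (Σ-*ˡ x (signed f i) M)
    (Σ-cong {λ m → x * signed f i m} {signed (λ i m → x * f i m) i}
      (λ m → solve 4 (λ x s t f → x :* (s :* (t :* f)) := s :* (t :* (x :* f))) x (sign i) (sign m) (f i m)) M)) M)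

  Σ₂-product : ∀ (a b : ℕ → ℝ) M →
    Σ₂ (λ i m → a i * b m) M ≈ partialSum (alternating a) M * partialSum (alternating b) M
  Σ₂-product a b M = sym (trans (Σ-*ʳ (partialSum (alternating b) M) (alternating a) M)
    (Σ-cong {λ i → alternating a i * partialSum (alternating b) M} (λ i → trans (Σ-*ˡ (alternating a i) (alternating b) M)
      (Σ-cong {λ m → alternating a i * alternating b m} {signed (λ i m → a i * b m) i}
        (λ m → solve 4 (λ s x t y → s :* x :* (t :* y) := s :* (t :* (x :* y))) (sign i) (a i) (sign m) (b m)) M)) M))

  Σ-zero : ∀ {f : ℕ → ℝ} → (∀ i → f i ≈ 0#) → ∀ n → partialSum f n ≈ 0#
  Σ-zero eq n = trans (Σ-cong {g = λ _ → 0#} eq n) (trans (Σ-const 0# n) (zeroʳ _))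

  Σ₂-Σ : ∀ (f : ℕ → ℕ → ℕ → ℝ) n M →
    Σ₂ (λ i m → partialSum (λ j → f j i m) n) M ≈ partialSum (λ j → Σ₂ (f j) M) n
  Σ₂-Σ f zero    M = Σ-zero {λ i → partialSum (signed (λ _ _ → 0#) i) M} (λ i → Σ-zero {signed (λ _ _ → 0#) i}
    (λ m → trans (*-congˡ (zeroʳ (sign m))) (zeroʳ (sign i))) M) M
  Σ₂-Σ f (suc n) M = trans (sym (Σ₂-+ (f 0) (λ i m → partialSum (λ j → f (suc j) i m) n) M))
    (+-congˡ (Σ₂-Σ (λ j → f (suc j)) n M))

  ⟶-Σ : ∀ {u : ℕ → ℕ → ℝ} {l : ℕ → ℝ} n → (∀ j → j ℕ.< n → (λ M → u M j) ⟶ l j) →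
    (λ M → partialSum (u M) n) ⟶ partialSum l n
  ⟶-Σ zero    h = ⟶-const
  ⟶-Σ (suc n) h = ⟶-+ (h 0 ℕ.z<s) (⟶-Σ n (λ j j<n → h (suc j) (ℕ.s<s j<n)))

  neg-* : ∀ a x n → (- a * x) ^ n ≈ sign n * a ^ n * x ^ n
  neg-* a x n = trans (^-distrib-* (- a) x n) (*-congʳ (trans
    (^-congˡ n (solve 1 (λ a → :- a := :- :1 :* a) a)) (^-distrib-* (- 1#) a n)))

  -- The usual factorisation of xⁿ - yⁿ multiplied by x, so that the exponents are n - j, never 0
  -- for j < n, instead of n - 1 - j.
  geometric-factor : ∀ x y n →
    (x - y) * partialSum (λ j → x ^ (n ℕ.∸ j) * y ^ j) n ≈ x * (x ^ n - y ^ n)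
  geometric-factor x y zero    = solve 2 (λ x y → (x :- y) :* con (+ 0) := x :* (:1 :- :1)) x y
  geometric-factor x y (suc n) = begin
    (x - y) * (x ^ suc n * 1# + partialSum (λ j → x ^ (n ℕ.∸ j) * (y * y ^ j)) n)
      ≈⟨ *-congˡ (+-congˡ (Σ-cong (λ j → solve 3 (λ p y q → p :* (y :* q) := y :* (p :* q)) (x ^ (n ℕ.∸ j)) y (y ^ j)) n)) ⟩
    (x - y) * (x ^ suc n * 1# + partialSum (λ j → y * (x ^ (n ℕ.∸ j) * y ^ j)) n)
      ≈⟨ *-congˡ (+-congˡ (Σ-*ˡ y (λ j → x ^ (n ℕ.∸ j) * y ^ j) n)) ⟨
    (x - y) * (x ^ suc n * 1# + y * g)
      ≈⟨ solve 4 (λ x y p g → (x :- y) :* (x :* p :* :1 :+ y :* g) := (x :- y) :* (x :* p) :+ y :* ((x :- y) :* g)) x y (x ^ n) g ⟩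
    (x - y) * (x * x ^ n) + y * ((x - y) * g)
      ≈⟨ +-congˡ (*-congˡ (geometric-factor x y n)) ⟩
    (x - y) * (x * x ^ n) + y * (x * (x ^ n - y ^ n))
      ≈⟨ solve 4 (λ x y p q → (x :- y) :* (x :* p) :+ y :* (x :* (p :- q)) := x :* (x :* p :- y :* q)) x y (x ^ n) (y ^ n) ⟩
    x * (x ^ suc n - y ^ suc n) ∎
    where g = partialSum (λ j → x ^ (n ℕ.∸ j) * y ^ j) n

  -- The pair of kernels under αβ = π².

  module Duality {ζ : ℂ → ℂ} (isζ : IsAlternatingHurwitzZeta 1⁺ ζ)
    (α β : ℝ⁺) (αβ : val (α *⁺ β) ≈ val (π *⁺ π)) (k : ℕ) .{{_ : NonZero k}} where

    open Zeta isζ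
    open FixedOrder k
    module Kα = Kernel α
    module Kβ = Kernel β

    p : ℝ
    p = val (π ⁻¹)

    αpβp : (val α * p) * (val β * p) ≈ 1#
    αpβp = trans (solve 3 (λ a b p → a :* p :* (b :* p) := (a :* b) :* (p :* p)) (val α) (val β) p)
      (trans (*-congʳ αβ) (trans (solve 2 (λ q p → q :* q :* (p :* p) := (q :* p) :* (q :* p)) (val π) p)
        (trans (*-cong (*-inverseʳ π) (*-inverseʳ π)) (*-identityˡ 1#))))

    ρ σ a b : ℝ
    ρ = Kα.X
    σ = Kβ.X
    a = val α ^ k
    b = val β ^ k

    ρσ : ρ * σ ≈ 1#
    ρσ = inverse-^ αpβp (2 ℕ.* k)

    -- β(α/π)² = α by αβ = π². This trades α^(kp) β^(k(N+1-p)) for a fixed power of b times ρ^p.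
    a≈bρ : a ≈ b * ρ
    a≈bρ = sym (begin
      b * (val α * p) ^ (2 ℕ.* k)            ≈⟨ *-congˡ (^-assocʳ (val α * p) 2 k) ⟨
      b * ((val α * p) ^ 2) ^ k              ≈⟨ ^-distrib-* (val β) ((val α * p) ^ 2) k ⟨
      (val β * (val α * p) ^ 2) ^ k          ≈⟨ ^-congˡ k (solve 3 (λ a b p → b :* (a :* p :* (a :* p :* :1)) := a :* (a :* p :* (b :* p))) (val α) (val β) p) ⟩
      (val α * (val α * p * (val β * p))) ^ k ≈⟨ ^-congˡ k (trans (*-congˡ αpβp) (*-identityʳ _)) ⟩
      a ∎)

    -- The denominators satisfy A m + σ A i = σ (A i + ρ A m), because ρσ = 1.
    κ-dual : ∀ i m → Kβ.κ i m ≈ ρ * Kα.κ m i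
    κ-dual i m = *-cancelʳ (+-pos (0<A m) (*-pos Kβ.0<X (0<A i)))
      (trans (trans (*-comm _ _) (Kβ.κ-inverse i m)) (sym (begin
        ρ * κ * (A m + σ * A i)              ≈⟨ solve 5 (λ r t a s b → r :* t :* (a :+ s :* b) := (r :* s :* b :+ r :* a) :* t) ρ κ (A m) σ (A i) ⟩
        (ρ * σ * A i + ρ * A m) * κ          ≈⟨ *-congʳ (+-congʳ (trans (*-congʳ ρσ) (*-identityˡ _))) ⟩
        (A i + ρ * A m) * κ                  ≈⟨ Kα.κ-inverse m i ⟩
        1#                                   ∎)))
      where κ = Kα.κ m i

    H : ℕ → ℕ → ℝ
    H q = partialSum (alternating (λ n → B n ^ q))

    Z : ℕ → ℝ
    Z q = re (ζ (fromℕ (2 ℕ.* k ℕ.* q)))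

    H⟶Z : ∀ q .{{_ : NonZero q}} → H q ⟶ Z q
    H⟶Z q = HasSum-resp {alternating (λ n → r n ^ (2 ℕ.* k ℕ.* q))} {alternating (λ n → B n ^ q)}
      (λ n → *-congˡ (sym (^-assocʳ (r n) (2 ℕ.* k) q))) refl
      (proj₁ (ζ-ℕ (2 ℕ.* k ℕ.* q) {{ℕₚ.m*n≢0 (2 ℕ.* k) q {{ℕₚ.m*n≢0 2 k}}}}))

    Z-0 : Z 0 ≈ ½
    Z-0 = ½-unique (≡.subst (λ m → re (ζ (fromℕ m)) + re (ζ (fromℕ m)) ≈ 1#) (≡.sym (ℕₚ.*-zeroʳ (2 ℕ.* k))) (proj₁ ζ-0))

    ζ-IsReal : ∀ m → IsReal (ζ (fromℕ m))
    ζ-IsReal zero    = proj₂ ζ-0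
    ζ-IsReal (suc m) = proj₂ (ζ-ℕ (suc m))

    -- The residue gives the single sum; in the rest `A i` cancels one factor `B i`, which lowers
    -- the exponent from N + 1 to N.
    truncated-expand : ∀ γ N M → let open Kernel γ in
      truncated N M ≈ - ½ * H (suc N) M + Σ₂ (λ i m → X * κ i m * B i ^ N) M
    truncated-expand γ N M = begin
      truncated N M
        ≈⟨ Σ-cong {λ i → sign i * (- ½ + X * A i * P i M) * B i ^ suc N} {λ i → - ½ * alternating (λ n → B n ^ suc N) i + sign i * (X * B i ^ N) * P i M} split M ⟩
      partialSum (λ i → - ½ * alternating (λ n → B n ^ suc N) i + sign i * (X * B i ^ N) * P i M) M
        ≈⟨ Σ-+ (λ i → - ½ * alternating (λ n → B n ^ suc N) i) (λ i → sign i * (X * B i ^ N) * P i M) M ⟩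
      partialSum (λ i → - ½ * alternating (λ n → B n ^ suc N) i) M + partialSum (λ i → sign i * (X * B i ^ N) * P i M) M
        ≈⟨ +-cong (sym (Σ-*ˡ (- ½) (alternating (λ n → B n ^ suc N)) M)) (Σ-cong expand M) ⟩
      - ½ * H (suc N) M + Σ₂ (λ i m → X * κ i m * B i ^ N) M ∎
      where
      open Kernel γ
      split : ∀ i → sign i * (- ½ + X * A i * P i M) * B i ^ suc N
                  ≈ - ½ * alternating (λ n → B n ^ suc N) i + sign i * (X * B i ^ N) * P i M
      split i = trans
        (solve 6 (λ s h x a p q → s :* (:- h :+ x :* a :* p) :* q := :- h :* (s :* q) :+ s :* (x :* (a :* q)) :* p)
          (sign i) ½ X (A i) (P i M) (B i ^ suc N))
        (+-congˡ (*-congʳ (*-congˡ (*-congˡ (A*B^ i N)))))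
      expand : ∀ i → sign i * (X * B i ^ N) * P i M ≈ partialSum (λ m → sign i * (sign m * (X * κ i m * B i ^ N))) M
      expand i = trans (Σ-*ˡ (sign i * (X * B i ^ N)) (alternating (κ i)) M)
        (Σ-cong (λ m → solve 5 (λ s x q t z → s :* (x :* q) :* (t :* z) := s :* (t :* (x :* z :* q))) (sign i) X (B i ^ N) (sign m) (κ i m)) M)

    module _ (N : ℕ) where

      -- Equal to (-1)^N (α/β)^(k(N+1)), the ratio of the prefactors of the two series once both
      -- sides are multiplied by αβ.
      τ : ℝ
      τ = sign N * ρ ^ suc N

      coefficient : ℕ → ℝ
      coefficient j = sign j * ρ ^ suc j

      -- With x = B i and y = - ρ B m, κ i m = x B m / (x - y) and the left side is
      -- ρ κ i m (xᴺ - yᴺ).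
      partial-fractions : ∀ i m → ρ * Kα.κ i m * B i ^ N + - τ * (Kα.κ i m * B m ^ N)
        ≈ partialSum (λ j → coefficient j * (B i ^ (N ℕ.∸ j) * B m ^ suc j)) N
      partial-fractions i m = *-cancelʳ (0<B i) (begin
        (ρ * κ * x ^ N + - τ * (κ * B m ^ N)) * x
          ≈⟨ solve 7 (λ r t p s q w x → (r :* t :* p :+ :- (s :* (r :* q)) :* (t :* w)) :* x := r :* t :* (x :* (p :- s :* q :* w))) ρ κ (x ^ N) (sign N) (ρ ^ N) (B m ^ N) x ⟩
        ρ * κ * (x * (x ^ N - sign N * ρ ^ N * B m ^ N))
          ≈⟨ *-congˡ (*-congˡ (+-congˡ (-‿cong (neg-* ρ (B m) N)))) ⟨
        ρ * κ * (x * (x ^ N - y ^ N))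
          ≈⟨ *-congˡ (geometric-factor x y N) ⟨
        ρ * κ * ((x - y) * g)
          ≈⟨ solve 4 (λ r t d g → r :* t :* (d :* g) := r :* (d :* t) :* g) ρ κ (x - y) g ⟩
        ρ * ((x - y) * κ) * g
          ≈⟨ *-congʳ (*-congˡ denominator) ⟩
        ρ * (x * B m) * g
          ≈⟨ solve 4 (λ r x w g → r :* (x :* w) :* g := r :* w :* g :* x) ρ x (B m) g ⟩
        ρ * B m * g * x
          ≈⟨ *-congʳ (Σ-*ˡ (ρ * B m) (λ j → x ^ (N ℕ.∸ j) * y ^ j) N) ⟩
        partialSum (λ j → ρ * B m * (x ^ (N ℕ.∸ j) * y ^ j)) N * x
          ≈⟨ *-congʳ (Σ-cong coefficients N) ⟩
        partialSum (λ j → coefficient j * (x ^ (N ℕ.∸ j) * B m ^ suc j)) N * x ∎)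
        where
        κ = Kα.κ i m
        x = B i
        y = - ρ * B m
        g = partialSum (λ j → x ^ (N ℕ.∸ j) * y ^ j) N
        denominator : (x - y) * κ ≈ x * B m
        denominator = begin
          (x - y) * κ
            ≈⟨ *-congʳ (+-cong (trans (*-congʳ (A*B m)) (*-identityˡ x)) (-‿cong (trans (*-congʳ (A*B i)) (*-identityˡ y)))) ⟨
          (A m * B m * x - A i * B i * y) * κ
            ≈⟨ solve 6 (λ a w x e r t → (a :* w :* x :- e :* x :* (:- r :* w)) :* t := x :* w :* ((a :+ r :* e) :* t)) (A m) (B m) x (A i) ρ κ ⟩
          x * B m * ((A m + ρ * A i) * κ)
            ≈⟨ trans (*-congˡ (Kα.κ-inverse i m)) (*-identityʳ _) ⟩
          x * B m ∎
        coefficients : ∀ j → ρ * B m * (x ^ (N ℕ.∸ j) * y ^ j) ≈ coefficient j * (x ^ (N ℕ.∸ j) * B m ^ suc j)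
        coefficients j = trans (*-congˡ (*-congˡ (neg-* ρ (B m) j)))
          (solve 6 (λ r w p s q v → r :* w :* (p :* (s :* q :* v)) := s :* (r :* q) :* (p :* (w :* v))) ρ (B m) (x ^ (N ℕ.∸ j)) (sign j) (ρ ^ j) (B m ^ j))

      finite-identity : ∀ M → Kα.truncated N M + - τ * Kβ.truncated N M
        ≈ (- ½ + τ * ½) * H (suc N) M + partialSum (λ j → coefficient j * (H (N ℕ.∸ j) M * H (suc j) M)) N
      finite-identity M = begin
        Kα.truncated N M + - τ * Kβ.truncated N M
          ≈⟨ +-cong (truncated-expand α N M) (*-congˡ (trans (truncated-expand β N M) (+-congˡ dual))) ⟩
        (- ½ * H K M + Dα) + - τ * (- ½ * H K M + Dβ)
          ≈⟨ solve 5 (λ h e d τ f → (:- h :* e :+ d) :+ :- τ :* (:- h :* e :+ f) := (:- h :+ τ :* h) :* e :+ (d :+ :- τ :* f)) ½ (H K M) Dα τ Dβ ⟩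
        (- ½ + τ * ½) * H K M + (Dα + - τ * Dβ)
          ≈⟨ +-congˡ combine ⟩
        (- ½ + τ * ½) * H K M + partialSum (λ j → coefficient j * (H (N ℕ.∸ j) M * H (suc j) M)) N ∎
        where
        K = suc N
        Dα = Σ₂ (λ i m → ρ * Kα.κ i m * B i ^ N) M
        Dβ = Σ₂ (λ i m → Kα.κ i m * B m ^ N) M
        -- The β kernel is the transposed α kernel, and transposing the square interchanges i and m.
        dual : Σ₂ (λ i m → σ * Kβ.κ i m * B i ^ N) M ≈ Dβ
        dual = trans (Σ₂-cong {λ i m → σ * Kβ.κ i m * B i ^ N} {λ i m → Kα.κ m i * B i ^ N}
            (λ i m → *-congʳ (trans (*-congˡ (κ-dual i m)) (trans (sym (*-assoc _ _ _))
              (trans (*-congʳ (trans (*-comm σ ρ) ρσ)) (*-identityˡ _))))) M)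
          (Σ₂-comm (λ i m → Kα.κ m i * B i ^ N) M)
        combine : Dα + - τ * Dβ ≈ partialSum (λ j → coefficient j * (H (N ℕ.∸ j) M * H (suc j) M)) N
        combine = begin
          Dα + - τ * Dβ
            ≈⟨ +-congˡ (Σ₂-*ˡ (- τ) (λ i m → Kα.κ i m * B m ^ N) M) ⟩
          Dα + Σ₂ (λ i m → - τ * (Kα.κ i m * B m ^ N)) M
            ≈⟨ Σ₂-+ (λ i m → ρ * Kα.κ i m * B i ^ N) (λ i m → - τ * (Kα.κ i m * B m ^ N)) M ⟩
          Σ₂ (λ i m → ρ * Kα.κ i m * B i ^ N + - τ * (Kα.κ i m * B m ^ N)) M
            ≈⟨ Σ₂-cong {λ i m → ρ * Kα.κ i m * B i ^ N + - τ * (Kα.κ i m * B m ^ N)} partial-fractions M ⟩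
          Σ₂ (λ i m → partialSum (λ j → coefficient j * (B i ^ (N ℕ.∸ j) * B m ^ suc j)) N) M
            ≈⟨ Σ₂-Σ (λ j i m → coefficient j * (B i ^ (N ℕ.∸ j) * B m ^ suc j)) N M ⟩
          partialSum (λ j → Σ₂ (λ i m → coefficient j * (B i ^ (N ℕ.∸ j) * B m ^ suc j)) M) N
            ≈⟨ Σ-cong (λ j → trans (sym (Σ₂-*ˡ (coefficient j) (λ i m → B i ^ (N ℕ.∸ j) * B m ^ suc j) M))
                 (*-congˡ (Σ₂-product (λ i → B i ^ (N ℕ.∸ j)) (λ m → B m ^ suc j) M))) N ⟩
          partialSum (λ j → coefficient j * (H (N ℕ.∸ j) M * H (suc j) M)) N ∎

      limit-identity : val α * Kα.S N + - τ * (val β * Kβ.S N)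
        ≈ (- ½ + τ * ½) * Z (suc N) + partialSum (λ j → coefficient j * (Z (N ℕ.∸ j) * Z (suc j))) N
      limit-identity = ⟶-unique
        (⟶-resp finite-identity refl (⟶-+ (Kα.truncated-limit N) (⟶-*ˡ (- τ) (Kβ.truncated-limit N))))
        (⟶-+ (⟶-*ˡ (- ½ + τ * ½) (H⟶Z (suc N)))
          -- The condition j < N keeps the index N - j positive; at index 0 the partial sums `H 0 M`
          -- oscillate.
          (⟶-Σ {λ M j → coefficient j * (H (N ℕ.∸ j) M * H (suc j) M)} N λ j j<N →
            ⟶-*ˡ (coefficient j) (⟶-* (H⟶Z (N ℕ.∸ j) {{ℕ.>-nonZero (ℕₚ.m<n⇒0<n∸m j<N)}}) (H⟶Z (suc j)))))

      -- The term of the final sum multiplied by αβ and divided by b^(N+1), which leaves ρ as the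
      -- only parameter.
      zetaTerm : ℕ → ℝ
      zetaTerm q = sign (q ℕ.+ 1) * ρ ^ q * (Z q * Z (suc N ℕ.∸ q))

      -- The two end terms, through `Z-0`, are the residue contributions -1/2 and τ/2; the inner
      -- term q = j + 1 is the j-th partial-fraction term.
      zetaTerm-sum : partialSum zetaTerm (suc (suc N))
        ≈ (- ½ + τ * ½) * Z (suc N) + partialSum (λ j → coefficient j * (Z (N ℕ.∸ j) * Z (suc j))) N
      zetaTerm-sum = begin
        zetaTerm 0 + partialSum (λ j → zetaTerm (suc j)) (suc N)
          ≈⟨ +-cong first (trans (Σ-snoc (λ j → zetaTerm (suc j)) N) (+-cong (Σ-cong middle N) final)) ⟩
        - ½ * Z (suc N) + (Σ′ + τ * ½ * Z (suc N))
          ≈⟨ solve 4 (λ h z s τ → :- h :* z :+ (s :+ τ :* h :* z) := (:- h :+ τ :* h) :* z :+ s) ½ (Z (suc N)) Σ′ τ ⟩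
        (- ½ + τ * ½) * Z (suc N) + Σ′ ∎
        where
        Σ′ = partialSum (λ j → coefficient j * (Z (N ℕ.∸ j) * Z (suc j))) N
        first : zetaTerm 0 ≈ - ½ * Z (suc N)
        first = trans (*-congˡ (*-congʳ Z-0))
          (solve 2 (λ h z → :- :1 :* :1 :* :1 :* (h :* z) := :- h :* z) ½ (Z (suc N)))
        double-sign : ∀ j → sign (suc j ℕ.+ 1) ≈ sign j
        double-sign j = trans (reflexive (≡.cong sign (ℕₚ.+-comm (suc j) 1)))
          (solve 1 (λ s → :- :1 :* (:- :1 :* s) := s) (sign j))
        middle : ∀ j → zetaTerm (suc j) ≈ coefficient j * (Z (N ℕ.∸ j) * Z (suc j))
        middle j = *-cong (*-congʳ (double-sign j)) (*-comm _ _)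
        final : zetaTerm (suc N) ≈ τ * ½ * Z (suc N)
        final = trans (*-cong (*-congʳ (double-sign N))
            (trans (*-comm _ _) (*-congʳ (trans (reflexive (≡.cong Z (ℕₚ.n∸n≡0 N))) Z-0))))
          (sym (*-assoc _ _ _))

      statementTerm : ℕ → ℝ
      statementTerm q = sign (q ℕ.+ 1) * Z q * Z (suc N ℕ.∸ q)
        * val (α ^ℤ (k ℕ.* q ⊖ 1) *⁺ β ^ℤ (k ℕ.* (suc N ℕ.∸ q) ⊖ 1))

      αβ⁺ = val α * val β

      statementTerm≈ : ∀ q → q ℕ.≤ suc N → statementTerm q * αβ⁺ ≈ b ^ suc N * zetaTerm q
      statementTerm≈ q q≤K = begin
        s * z * w * (u * v) * (val α * val β)
          ≈⟨ solve 7 (λ s z w u v a b → s :* z :* w :* (u :* v) :* (a :* b) := s :* (z :* w) :* ((u :* a) :* (v :* b))) s z w u v (val α) (val β) ⟩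
        s * (z * w) * ((u * val α) * (v * val β))
          ≈⟨ *-congˡ (*-cong (pred-power α q) (pred-power β (suc N ℕ.∸ q))) ⟩
        s * (z * w) * (a ^ q * b ^ (suc N ℕ.∸ q))
          ≈⟨ *-congˡ (*-congʳ (trans (^-congˡ q a≈bρ) (^-distrib-* b ρ q))) ⟩
        s * (z * w) * (b ^ q * ρ ^ q * b ^ (suc N ℕ.∸ q))
          ≈⟨ solve 5 (λ s z b r τ → s :* z :* (b :* r :* τ) := (b :* τ) :* (s :* r :* z)) s (z * w) (b ^ q) (ρ ^ q) (b ^ (suc N ℕ.∸ q)) ⟩
        (b ^ q * b ^ (suc N ℕ.∸ q)) * zetaTerm q
          ≈⟨ *-congʳ (trans (sym (^-homo-* b q (suc N ℕ.∸ q))) (^-congʳ b (ℕₚ.m+[n∸m]≡n q≤K))) ⟩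
        b ^ suc N * zetaTerm q ∎
        where
        s = sign (q ℕ.+ 1)
        z = Z q
        w = Z (suc N ℕ.∸ q)
        u = val (α ^ℤ (k ℕ.* q ⊖ 1))
        v = val (β ^ℤ (k ℕ.* (suc N ℕ.∸ q) ⊖ 1))
        pred-power : ∀ γ q → val (γ ^ℤ (k ℕ.* q ⊖ 1)) * val γ ≈ (val γ ^ k) ^ q
        pred-power γ q = trans (^ℤ-pred γ (k ℕ.* q)) (sym (^-assocʳ (val γ) k q))

      -- Multiplying by αβ removes every -1 from the exponents; what remains is `limit-identity`
      -- times b^(N+1).
      real-identity : val (β ^ℤ (k ℕ.* suc N ⊖ 1)) * Kα.S N
        ≈ sign N * val (α ^ℤ (k ℕ.* suc N ⊖ 1)) * Kβ.S N + partialSum statementTerm (suc (suc N))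
      real-identity = *-cancelʳ (*-pos (pos α) (pos β)) (begin
        v * Sα * αβ⁺
          ≈⟨ solve 4 (λ v s a b → v :* s :* (a :* b) := (v :* b) :* (a :* s)) v Sα (val α) (val β) ⟩
        (v * val β) * (val α * Sα)
          ≈⟨ *-congʳ (trans (^ℤ-pred β (k ℕ.* suc N)) (sym (^-assocʳ (val β) k (suc N)))) ⟩
        b ^ suc N * (val α * Sα)
          ≈⟨ solve 4 (λ b x τ y → b :* x := τ :* b :* y :+ b :* (x :+ :- τ :* y)) (b ^ suc N) (val α * Sα) τ (val β * Sβ) ⟩
        τ * b ^ suc N * (val β * Sβ) + b ^ suc N * (val α * Sα + - τ * (val β * Sβ))
          ≈⟨ +-cong second (trans (*-congˡ (trans limit-identity (sym zetaTerm-sum))) sums) ⟩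
        sign N * u * Sβ * αβ⁺ + partialSum statementTerm (suc (suc N)) * αβ⁺
          ≈⟨ distribʳ αβ⁺ _ _ ⟨
        (sign N * u * Sβ + partialSum statementTerm (suc (suc N))) * αβ⁺ ∎)
        where
        Sα = Kα.S N
        Sβ = Kβ.S N
        u = val (α ^ℤ (k ℕ.* suc N ⊖ 1))
        v = val (β ^ℤ (k ℕ.* suc N ⊖ 1))
        second : τ * b ^ suc N * (val β * Sβ) ≈ sign N * u * Sβ * αβ⁺
        second = begin
          sign N * ρ ^ suc N * b ^ suc N * (val β * Sβ)
            ≈⟨ solve 5 (λ s r p b t → s :* r :* p :* (b :* t) := s :* (p :* r) :* (b :* t)) (sign N) (ρ ^ suc N) (b ^ suc N) (val β) Sβ ⟩
          sign N * (b ^ suc N * ρ ^ suc N) * (val β * Sβ)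
            ≈⟨ *-congʳ (*-congˡ (trans (^-congˡ (suc N) a≈bρ) (^-distrib-* b ρ (suc N)))) ⟨
          sign N * a ^ suc N * (val β * Sβ)
            ≈⟨ *-congʳ (*-congˡ (trans (^ℤ-pred α (k ℕ.* suc N)) (sym (^-assocʳ (val α) k (suc N))))) ⟨
          sign N * (u * val α) * (val β * Sβ)
            ≈⟨ solve 5 (λ s u a b t → s :* (u :* a) :* (b :* t) := s :* u :* t :* (a :* b)) (sign N) u (val α) (val β) Sβ ⟩
          sign N * u * Sβ * αβ⁺ ∎
        sums : b ^ suc N * partialSum zetaTerm (suc (suc N)) ≈ partialSum statementTerm (suc (suc N)) * αβ⁺
        sums = trans (Σ-*ˡ (b ^ suc N) zetaTerm (suc (suc N))) (sym (trans (Σ-*ʳ αβ⁺ statementTerm (suc (suc N)))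
          (Σ-cong-< {λ q → statementTerm q * αβ⁺} {λ q → b ^ suc N * zetaTerm q} (suc (suc N)) (λ q q<K+1 → statementTerm≈ q (ℕₚ.≤-pred q<K+1)))))

    complexTerm : ℕ → ℕ → ℂ
    complexTerm K q = ι (sign (q ℕ.+ 1))
      C.* ζ (fromℕ (2 ℕ.* k ℕ.* q))
      C.* ζ (fromℕ (2 ℕ.* k ℕ.* (K ℕ.∸ q)))
      C.* ι (val (α ^ℤ (k ℕ.* q ⊖ 1) *⁺ β ^ℤ (k ℕ.* (K ℕ.∸ q) ⊖ 1)))

    re-complexTerm : ∀ N q → re (complexTerm (suc N) q) ≈ statementTerm N q × IsReal (complexTerm (suc N) q)
    re-complexTerm N q =
        trans (re-* {s C.* z C.* w} {u} szw refl) (*-congʳ (trans (re-* {s C.* z} {w} sz w-real) (*-congʳ (re-* {s} {z} refl z-real))))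
      , IsReal-* {s C.* z C.* w} {u} szw refl
      where
      s z w u : ℂ
      s = ι (sign (q ℕ.+ 1))
      z = ζ (fromℕ (2 ℕ.* k ℕ.* q))
      w = ζ (fromℕ (2 ℕ.* k ℕ.* (suc N ℕ.∸ q)))
      u = ι (val (α ^ℤ (k ℕ.* q ⊖ 1) *⁺ β ^ℤ (k ℕ.* (suc N ℕ.∸ q) ⊖ 1)))
      z-real : IsReal z
      z-real = ζ-IsReal (2 ℕ.* k ℕ.* q)
      w-real : IsReal w
      w-real = ζ-IsReal (2 ℕ.* k ℕ.* (suc N ℕ.∸ q))
      sz : IsReal (s C.* z)
      sz = IsReal-* {s} {z} refl z-real
      szw : IsReal (s C.* z C.* w)
      szw = IsReal-* {s C.* z} {w} sz w-real

    -- N + 1 and N + 2 do not reduce to successors, so K and L are left as variables and the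
    -- equations are matched away.
    reciprocity : ∀ N {K L} → K ≡ suc N → L ≡ suc (suc N) →
      ∃[ Sα ] ∃[ Sβ ] (HasSum (Kα.term K) Sα × HasSum (Kβ.term K) Sβ ×
        (ι (val (β ^ℤ (k ℕ.* K ⊖ 1)) * Sα)
         C.≈ ι (sign N * val (α ^ℤ (k ℕ.* K ⊖ 1)) * Sβ) C.+ C.sum {L} (λ i → complexTerm K (toℕ i))))
    reciprocity N ≡.refl ≡.refl = Kα.S N , Kβ.S N , Kα.term-sum N , Kβ.term-sum N
      , trans (real-identity N) (+-congˡ (sym (trans (re-sum (complexTerm (suc N)) (suc (suc N)))
          (Σ-cong {λ q → re (complexTerm (suc N) q)} {statementTerm N} (λ q → proj₁ (re-complexTerm N q)) (suc (suc N))))))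
      , sym (trans (+-identityˡ _) (IsReal-sum (complexTerm (suc N)) (λ q → proj₂ (re-complexTerm N q)) (suc (suc N))))

corollary1p23 :
  {c ℓ₁ ℓ₂ ℓ₃ : Level} (R : RealField c ℓ₁ ℓ₂ ℓ₃) → let open Analysis R in
  (ζ : ℂ → ℂ) → IsAlternatingHurwitzZeta 1⁺ ζ →
  (α β : ℝ⁺) → val (α *⁺ β) ≈ val (π *⁺ π) →
  (k N : ℕ) .{{_ : NonZero k}} .{{_ : NonZero N}} →
  let
    -- the n-th term of the series for F_γ, with n = i + 1
    term : ℝ⁺ → ℕ → ℝ
    term γ i = let n = fromℕ⁺ (suc i) in
      sign i * F[ γ ] n 1⁺ k * val ((n ^ℤ (2 ℕ.* k ℕ.* (N ℕ.+ 1) ⊖ 1)) ⁻¹)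
  in
  ∃[ Sα ] ∃[ Sβ ] (HasSum (term α) Sα × HasSum (term β) Sβ ×
    (ι (val (β ^ℤ (k ℕ.* (N ℕ.+ 1) ⊖ 1)) * Sα)
     C.≈
     ι (sign N * val (α ^ℤ (k ℕ.* (N ℕ.+ 1) ⊖ 1)) * Sβ)
     C.+ C.sum {N ℕ.+ 2} (λ i → let p = toℕ i in
       ι (sign (p ℕ.+ 1))
       C.* ζ (fromℕ (2 ℕ.* k ℕ.* p))
       C.* ζ (fromℕ (2 ℕ.* k ℕ.* (N ℕ.+ 1 ℕ.∸ p)))
       C.* ι (val (α ^ℤ (k ℕ.* p ⊖ 1) *⁺ β ^ℤ (k ℕ.* (N ℕ.+ 1 ℕ.∸ p) ⊖ 1))))))
corollary1p23 R ζ isζ α β αβ k N =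
  Reciprocity.Duality.reciprocity R isζ α β αβ k N (ℕₚ.+-comm N 1) (ℕₚ.+-comm N 2)
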